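{- Suppose that the basic sequence $Q$ is infinite in limit and fully divergent. Then $N(Q)\setminus DN(Q)\ne\emptyset$.
   Context: A basic sequence is a sequence $Q=(q_n)_{n\ge1}$ of integers $q_n\ge 2$. The $Q$-Cantor series expansion of $x\in\mathbb{R}$ is the unique expansion $x=E_0+\sum_{n\ge1}\frac{E_n}{q_1\cdots q_n}$ with $E_0=\lfloor x\rfloor$, $E_n\in\{0,\ldots,q_n-1\}$ for $n\ge 1$, and $E_n\ne q_n-1$ infinitely often. $Q$ is infinite in limit if $q_n\to\infty$. Put $Q_n^{(k)}=\sum_{j=1}^n\frac1{q_jq_{j+1}\cdots q_{j+k-1}}$; $Q$ is fully divergent if $\lim_nQ_n^{(k)}=\infty$ for all $k\ge1$. A block of length $k$ is an ordered $k$-tuple of non-negative integers, and $N_n^Q(B,x)$ is the number of occurrences of $B$ starting at positions $\le n$ in the digits $E_1,E_2,\ldots$ of $x$. $N(Q)$ is the set of $x\in\mathbb{R}$ with $\lim_nN_n^Q(B,x)/Q_n^{(k)}=1$ for all $k\ge1$ and all blocks $B$ of length $k$. $DN(Q)$ is the set of $x\in\mathbb{R}$ such that $(q_1\cdots q_nx\bmod1)_{n\ge0}$ is uniformly distributed mod $1$. -}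

module Defs where

open import Data.Nat.Base as ℕ using (ℕ; zero; suc)
import Data.Nat.Properties as ℕ
open import Data.Integer.Base as ℤ using (ℤ; +_)
open import Data.Rational.Base as ℚ using (ℚ; 0ℚ; 1ℚ; ½)
import Data.Rational.Properties as ℚ
import Data.Rational.Solver as ℚ-Solver
open import Data.Fin.Base using (toℕ)
open import Data.List.Base using (length; filter; upTo)
open import Data.Product.Base using (∃-syntax; _×_; _,_; proj₁; proj₂)
open import Data.Sum.Base using (inj₁; inj₂)
open import Data.Vec.Base using (Vec; tabulate)
open import Data.Vec.Properties using (≡-dec)
open import Relation.Binary.PropositionalEquality
  using (_≡_; _≢_; refl; sym; trans; cong; subst)
open import Relation.Nullary.Negation using (¬_)
open import Relation.Unary using (Pred; Decidable)
open import Level using (0ℓ)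

------------------------------------------------------------------------
-- Real numbers, as Cauchy sequences of rationals.  Sequences with the same
-- limit are not identified, but every predicate on reals below is invariant
-- under replacing a sequence by another one with the same limit.

IsCauchy : (ℕ → ℚ) → Set
IsCauchy s = ∀ ε → 0ℚ ℚ.< ε →
  ∃[ N ] (∀ m n → N ℕ.≤ m → N ℕ.≤ n → ℚ.∣ s m ℚ.- s n ∣ ℚ.< ε)

record ℝ : Set where
  constructor mkℝ
  field
    seq    : ℕ → ℚ
    cauchy : IsCauchy seq

open ℝ public

halves : ∀ ε → ½ ℚ.* ε ℚ.+ ½ ℚ.* ε ≡ ε
halves ε = trans (sym (ℚ.*-distribʳ-+ ε ½ ½)) (ℚ.*-identityˡ ε)

half-pos : ∀ {ε} → 0ℚ ℚ.< ε → 0ℚ ℚ.< ½ ℚ.* ε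
half-pos {ε} 0<ε =
  ℚ.positive⁻¹ (½ ℚ.* ε) {{ℚ.pos*pos⇒pos ½ ε {{ℚ.positive 0<ε}}}}

const-cauchy : ∀ c → IsCauchy (λ _ → c)
const-cauchy c ε 0<ε = 0 , λ _ _ _ _ →
  subst (λ z → ℚ.∣ z ∣ ℚ.< ε) (sym (ℚ.+-inverseʳ c)) 0<ε

minus-swap : ∀ a b c d →
  (a ℚ.- b) ℚ.- (c ℚ.- d) ≡ (a ℚ.- c) ℚ.- (b ℚ.- d)
minus-swap = solve 4 (λ a b c d →
    (a :- b) :- (c :- d) := (a :- c) :- (b :- d)) refl
  where open ℚ-Solver.+-*-Solver

minus-cauchy : ∀ x y → IsCauchy (λ n → seq x n ℚ.- seq y n)
minus-cauchy x y ε 0<ε = Nx ℕ.+ Ny , λ m n N≤m N≤n → begin-strict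
  ℚ.∣ (seq x m ℚ.- seq y m) ℚ.- (seq x n ℚ.- seq y n) ∣
    ≡⟨ cong ℚ.∣_∣ (minus-swap (seq x m) (seq y m) (seq x n) (seq y n)) ⟩
  ℚ.∣ (seq x m ℚ.- seq x n) ℚ.- (seq y m ℚ.- seq y n) ∣
    ≤⟨ ℚ.∣p-q∣≤∣p∣+∣q∣ (seq x m ℚ.- seq x n) (seq y m ℚ.- seq y n) ⟩
  ℚ.∣ seq x m ℚ.- seq x n ∣ ℚ.+ ℚ.∣ seq y m ℚ.- seq y n ∣
    <⟨ ℚ.+-mono-<
         (proj₂ cx m n (ℕ.m+n≤o⇒m≤o Nx N≤m) (ℕ.m+n≤o⇒m≤o Nx N≤n))
         (proj₂ cy m n (ℕ.m+n≤o⇒n≤o Nx N≤m) (ℕ.m+n≤o⇒n≤o Nx N≤n)) ⟩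
  ½ ℚ.* ε ℚ.+ ½ ℚ.* ε
    ≡⟨ halves ε ⟩
  ε ∎
  where
  open ℚ.≤-Reasoning
  cx = cauchy x (½ ℚ.* ε) (half-pos 0<ε)
  cy = cauchy y (½ ℚ.* ε) (half-pos 0<ε)
  Nx = proj₁ cx
  Ny = proj₁ cy

∣p∣-∣q∣≤∣p-q∣ : ∀ p q → ℚ.∣ p ∣ ℚ.- ℚ.∣ q ∣ ℚ.≤ ℚ.∣ p ℚ.- q ∣
∣p∣-∣q∣≤∣p-q∣ p q = begin
  ℚ.∣ p ∣ ℚ.- ℚ.∣ q ∣
    ≡⟨ cong (λ z → ℚ.∣ z ∣ ℚ.- ℚ.∣ q ∣)
         (solve 2 (λ p q → p := (p :- q) :+ q) refl p q) ⟩
  ℚ.∣ (p ℚ.- q) ℚ.+ q ∣ ℚ.- ℚ.∣ q ∣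
    ≤⟨ ℚ.+-monoˡ-≤ (ℚ.- ℚ.∣ q ∣) (ℚ.∣p+q∣≤∣p∣+∣q∣ (p ℚ.- q) q) ⟩
  (ℚ.∣ p ℚ.- q ∣ ℚ.+ ℚ.∣ q ∣) ℚ.- ℚ.∣ q ∣
    ≡⟨ solve 2 (λ a b → (a :+ b) :- b := a) refl ℚ.∣ p ℚ.- q ∣ ℚ.∣ q ∣ ⟩
  ℚ.∣ p ℚ.- q ∣ ∎
  where
  open ℚ.≤-Reasoning
  open ℚ-Solver.+-*-Solver

∣∣p∣-∣q∣∣≤∣p-q∣ : ∀ p q → ℚ.∣ ℚ.∣ p ∣ ℚ.- ℚ.∣ q ∣ ∣ ℚ.≤ ℚ.∣ p ℚ.- q ∣
∣∣p∣-∣q∣∣≤∣p-q∣ p q with ℚ.∣p∣≡p∨∣p∣≡-p (ℚ.∣ p ∣ ℚ.- ℚ.∣ q ∣)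
... | inj₁ e = ℚ.≤-trans (ℚ.≤-reflexive e) (∣p∣-∣q∣≤∣p-q∣ p q)
... | inj₂ e = begin
  ℚ.∣ ℚ.∣ p ∣ ℚ.- ℚ.∣ q ∣ ∣  ≡⟨ e ⟩
  ℚ.- (ℚ.∣ p ∣ ℚ.- ℚ.∣ q ∣)  ≡⟨ neg-minus ℚ.∣ p ∣ ℚ.∣ q ∣ ⟩
  ℚ.∣ q ∣ ℚ.- ℚ.∣ p ∣        ≤⟨ ∣p∣-∣q∣≤∣p-q∣ q p ⟩
  ℚ.∣ q ℚ.- p ∣              ≡⟨ cong ℚ.∣_∣ (neg-minus p q) ⟨
  ℚ.∣ ℚ.- (p ℚ.- q) ∣        ≡⟨ ℚ.∣-p∣≡∣p∣ (p ℚ.- q) ⟩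
  ℚ.∣ p ℚ.- q ∣              ∎
  where
  open ℚ.≤-Reasoning
  open ℚ-Solver.+-*-Solver
  neg-minus : ∀ a b → ℚ.- (a ℚ.- b) ≡ b ℚ.- a
  neg-minus = solve 2 (λ a b → :- (a :- b) := b :- a) refl

abs-cauchy : ∀ x → IsCauchy (λ n → ℚ.∣ seq x n ∣)
abs-cauchy x ε 0<ε = proj₁ cx , λ m n N≤m N≤n →
  ℚ.≤-<-trans (∣∣p∣-∣q∣∣≤∣p-q∣ (seq x m) (seq x n)) (proj₂ cx m n N≤m N≤n)
  where cx = cauchy x ε 0<ε

scale-cauchy : ∀ c x → IsCauchy (λ n → c ℚ.* seq x n)
scale-cauchy c x ε 0<ε = proj₁ cx , λ m n N≤m N≤n → begin-strict
  ℚ.∣ c ℚ.* seq x m ℚ.- c ℚ.* seq x n ∣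
    ≡⟨ cong ℚ.∣_∣ (solve 3 (λ c a b → c :* a :- c :* b := c :* (a :- b)) refl
         c (seq x m) (seq x n)) ⟩
  ℚ.∣ c ℚ.* (seq x m ℚ.- seq x n) ∣
    ≡⟨ ℚ.∣p*q∣≡∣p∣*∣q∣ c (seq x m ℚ.- seq x n) ⟩
  ℚ.∣ c ∣ ℚ.* ℚ.∣ seq x m ℚ.- seq x n ∣
    ≤⟨ ℚ.*-monoʳ-≤-nonNeg ℚ.∣ seq x m ℚ.- seq x n ∣
         {{ℚ.∣-∣-nonNeg (seq x m ℚ.- seq x n)}} ∣c∣≤d ⟩
  d ℚ.* ℚ.∣ seq x m ℚ.- seq x n ∣
    <⟨ ℚ.*-monoʳ-<-pos d (proj₂ cx m n N≤m N≤n) ⟩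
  d ℚ.* (ℚ.1/ d ℚ.* ε)
    ≡⟨ ℚ.*-assoc d (ℚ.1/ d) ε ⟨
  (d ℚ.* ℚ.1/ d) ℚ.* ε
    ≡⟨ cong (ℚ._* ε) (ℚ.*-inverseʳ d) ⟩
  1ℚ ℚ.* ε
    ≡⟨ ℚ.*-identityˡ ε ⟩
  ε ∎
  where
  open ℚ.≤-Reasoning
  open ℚ-Solver.+-*-Solver
  d = 1ℚ ℚ.+ ℚ.∣ c ∣
  instance
    d-pos : ℚ.Positive d
    d-pos = ℚ.pos+nonNeg⇒pos 1ℚ ℚ.∣ c ∣ {{ℚ.∣-∣-nonNeg c}}
    d-nonZero : ℚ.NonZero d
    d-nonZero = ℚ.pos⇒nonZero d
  ∣c∣≤d : ℚ.∣ c ∣ ℚ.≤ d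
  ∣c∣≤d = ℚ.≤-trans (ℚ.≤-reflexive (sym (ℚ.+-identityˡ ℚ.∣ c ∣)))
            (ℚ.+-monoˡ-≤ ℚ.∣ c ∣ (ℚ.<⇒≤ (ℚ.positive⁻¹ 1ℚ)))
  0<δ : 0ℚ ℚ.< ℚ.1/ d ℚ.* ε
  0<δ = ℚ.positive⁻¹ (ℚ.1/ d ℚ.* ε)
          {{ℚ.pos*pos⇒pos (ℚ.1/ d) {{ℚ.1/pos⇒pos d}} ε {{ℚ.positive 0<ε}}}}
  cx = cauchy x (ℚ.1/ d ℚ.* ε) 0<δ

infixl 6 _-_
infixl 7 _·_
infix  4 _<_ _≤_ _⟶_

fromℚ : ℚ → ℝ
fromℚ c = mkℝ (λ _ → c) (const-cauchy c)

fromℤ : ℤ → ℝ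
fromℤ m = fromℚ (m ℚ./ 1)

_-_ : ℝ → ℝ → ℝ
x - y = mkℝ (λ n → seq x n ℚ.- seq y n) (minus-cauchy x y)

_·_ : ℚ → ℝ → ℝ
c · x = mkℝ (λ n → c ℚ.* seq x n) (scale-cauchy c x)

∣_∣ : ℝ → ℝ
∣ x ∣ = mkℝ (λ n → ℚ.∣ seq x n ∣) (abs-cauchy x)

_<_ : ℝ → ℝ → Set
x < y = ∃[ δ ] (0ℚ ℚ.< δ ×
  ∃[ N ] (∀ n → N ℕ.≤ n → seq x n ℚ.+ δ ℚ.≤ seq y n))

_≤_ : ℝ → ℝ → Set
x ≤ y = ¬ (y < x)

_⟶_ : (ℕ → ℝ) → ℝ → Set
u ⟶ l = ∀ ε → 0ℚ ℚ.< ε →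
  ∃[ N ] (∀ n → N ℕ.≤ n → ∣ u n - l ∣ < fromℚ ε)

_⟶∞ : (ℕ → ℚ) → Set
u ⟶∞ = ∀ M → ∃[ N ] (∀ n → N ℕ.≤ n → M ℚ.< u n)

IsFloor : ℝ → ℤ → Set
IsFloor x m = fromℤ m ≤ x × x < fromℤ (m ℤ.+ + 1)

------------------------------------------------------------------------
-- Uniform distribution mod 1

count : {P : Pred ℕ 0ℓ} → Decidable P → ℕ → ℕ
count P? n = length (filter P? (upTo n))

FracIn[_,_⟩ : ℝ → ℝ → ℝ → Set
FracIn[ a , b ⟩ y = ∃[ m ] (IsFloor y m × a ≤ y - fromℤ m × y - fromℤ m < b)

-- Counting the indices n with y n mod 1 in [a , b) requires deciding
-- membership, which is not possible for reals constructively; hence the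
-- quantification over deciders P?.  Classically there is one, and the counts
-- do not depend on it.  Without excluded middle this makes uniform
-- distribution a weaker property, so its negation is a stronger one.
UniformlyDistributedMod1 : (ℕ → ℝ) → Set
UniformlyDistributedMod1 y =
  ∀ a b → fromℚ 0ℚ ≤ a → a < b → b ≤ fromℚ 1ℚ →
  (P? : Decidable (λ n → FracIn[ a , b ⟩ (y n))) →
  (λ n → fromℚ (+ count P? (suc n) ℚ./ suc n)) ⟶ b - a

------------------------------------------------------------------------
-- Cantor series

∏ : (ℕ → ℕ) → ℕ → ℕ
∏ f zero    = 1
∏ f (suc n) = ∏ f n ℕ.* f n

∑ : (ℕ → ℚ) → ℕ → ℚ
∑ f zero    = 0ℚ
∑ f (suc n) = ∑ f n ℚ.+ f n

-- Sequences indexed from 1 in the usual notation are indexed from 0 here: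
-- q n is q_{n+1}, and likewise digit n below is E_{n+1}.
record BasicSequence : Set where
  field
    q   : ℕ → ℕ
    q≥2 : ∀ n → 2 ℕ.≤ q n

  ∏-nonZero : ∀ i n → ℕ.NonZero (∏ (λ j → q (i ℕ.+ j)) n)
  ∏-nonZero i zero    = _
  ∏-nonZero i (suc n) =
    ℕ.m*n≢0 _ _ {{∏-nonZero i n}}
      {{ℕ.>-nonZero (ℕ.≤-trans (ℕ.s≤s ℕ.z≤n) (q≥2 (i ℕ.+ n)))}}

  -- 1 / (q_{i+1} q_{i+2} ⋯ q_{i+k})
  recip : ℕ → ℕ → ℚ
  recip i k = ℚ._/_ (+ 1) (∏ (λ j → q (i ℕ.+ j)) k) {{∏-nonZero i k}}

  -- Q_n^{(k)}
  Q⟨_⟩ : ℕ → ℕ → ℚ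
  Q⟨ k ⟩ n = ∑ (λ i → recip i k) n

  recip-pos : ∀ i k → ℚ.Positive (recip i k)
  recip-pos i k = ℚ.normalize-pos 1 _ {{∏-nonZero i k}}

  Q-nonNeg : ∀ k n → ℚ.NonNegative (Q⟨ k ⟩ n)
  Q-pos    : ∀ k n → ℚ.Positive (Q⟨ k ⟩ (suc n))
  Q-nonNeg k zero    = _
  Q-nonNeg k (suc n) = ℚ.pos⇒nonNeg (Q⟨ k ⟩ (suc n)) {{Q-pos k n}}
  Q-pos k n = ℚ.nonNeg+pos⇒pos (Q⟨ k ⟩ n) {{Q-nonNeg k n}}
                (recip n k) {{recip-pos n k}}

  Q-nonZero : ∀ k n → ℚ.NonZero (Q⟨ k ⟩ (suc n))
  Q-nonZero k n = ℚ.pos⇒nonZero (Q⟨ k ⟩ (suc n)) {{Q-pos k n}}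

InfiniteInLimit : BasicSequence → Set
InfiniteInLimit Q = (λ n → + q n ℚ./ 1) ⟶∞
  where open BasicSequence Q

FullyDivergent : BasicSequence → Set
FullyDivergent Q = ∀ k → 1 ℕ.≤ k → Q⟨ k ⟩ ⟶∞
  where open BasicSequence Q

record CantorExpansion (Q : BasicSequence) (x : ℝ) : Set where
  open BasicSequence Q
  field
    whole    : ℤ
    digit    : ℕ → ℕ
    floor    : IsFloor x whole
    digit<q  : ∀ n → digit n ℕ.< q n
    nonmax   : ∀ m → ∃[ n ] (m ℕ.≤ n × digit n ≢ q n ℕ.∸ 1)
    converge :
      (λ n → fromℚ (whole ℚ./ 1 ℚ.+
                    ∑ (λ i → + digit i ℚ./ 1 ℚ.* recip 0 (suc i)) n)) ⟶ x

occurrences : ∀ {k} → Vec ℕ k → (ℕ → ℕ) → ℕ → ℕ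
occurrences {k} B E =
  count (λ i → ≡-dec ℕ._≟_ (tabulate {n = k} (λ j → E (i ℕ.+ toℕ j))) B)

-- The expansion of x is unique when it exists, and classically it always
-- exists.  The quotients start at Q⟨ k ⟩ 1, because Q⟨ k ⟩ 0 = 0.
N : BasicSequence → ℝ → Set
N Q x = ∃[ E ] (∀ k → 1 ℕ.≤ k → (B : Vec ℕ k) →
    (λ n → fromℚ (ℚ._÷_
      (+ occurrences B (CantorExpansion.digit {Q} {x} E) (suc n) ℚ./ 1)
      (Q⟨ k ⟩ (suc n)) {{Q-nonZero k n}})) ⟶ fromℚ 1ℚ)
  where open BasicSequence Q

DN : BasicSequence → ℝ → Set
DN Q x = UniformlyDistributedMod1 (λ n → (+ ∏ q n ℚ./ 1) · x)
  where open BasicSequence Q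

{-# OPTIONS --safe #-}

-- By default the digit E_n is ⌊(q_n - 1)/2⌋, which tends to infinity and hence contributes only
-- finitely many occurrences of any fixed block.  Into this sequence isolated blocks are inserted
-- greedily: whenever no block is being written, the first block in an enumeration, among
-- finitely many active ones, that has been used at most Q_n^(k) - 1 times (k its length) is
-- written next.  Since q_n → ∞, Q_n^(k) grows so slowly that no block stays behind its target
-- Q_n^(k) by more than a constant.  A block also occurs inside longer inserted blocks, but
-- Q_n^(k+1) = o(Q_n^(k)), so if blocks become active slowly enough these occurrences are
-- negligible, and the number is Q-normal.  All its digits satisfy E_n < q_n / 2, so
-- q_1⋯q_n x mod 1 never exceeds 3/4 and the sequence cannot be uniformly distributed.
module Submission where

open import Defs
open import Data.Product.Base using (∃-syntax; _×_)
open import Relation.Nullary.Negation using (¬_)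

open import Data.Empty using (⊥-elim)
open import Data.Fin.Base using (toℕ)
open import Data.Integer.Base as ℤ using (ℤ; +_)
import Data.Integer.Properties as ℤ
open import Data.List.Base using (List; []; _∷_; filter; length; map; take; upTo)
open import Data.List.NonEmpty.Base using (List⁺; _∷_; toList)
open import Data.List.Properties using (≡-dec; filter-++; filter-accept; filter-reject;
  length-++; length-filter; length-upTo; take-all; upTo-∷ʳ; ∷-injectiveˡ; ∷-injectiveʳ)
open import Data.List.Relation.Unary.All as All using (All; []; _∷_)
open import Data.Nat.Base as ℕ using (ℕ; zero; suc; z≤n; s≤s; ⌊_/2⌋)
import Data.Nat.Properties as ℕ
open import Data.Nat.Binary.Base using (ℕᵇ; 2[1+_]; 1+[2_]; fromℕ) renaming (zero to 0ᵇ; toℕ to ℕᵇ-toℕ)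
open import Data.Nat.Binary.Properties using (fromℕ-toℕ; toℕ-fromℕ)
open import Data.Nat.ListAction using (sum)
import Data.Nat.Solver
open import Data.Product.Base using (Σ; _,_; proj₁; proj₂)
open import Data.Rational.Base as ℚ using (ℚ; 0ℚ; 1ℚ; ½)
import Data.Rational.Properties as ℚ
import Data.Rational.Solver as ℚ-Solver
import Data.Rational.Unnormalised.Base as ℚᵘ
import Data.Rational.Unnormalised.Properties as ℚᵘ
open import Data.Sum.Base using (_⊎_; inj₁; inj₂)
open import Data.Vec.Base as Vec using (Vec; []; _∷_; tabulate)
import Data.Vec.Properties as Vec
open import Level using (0ℓ)
open import Relation.Binary.PropositionalEquality
open import Relation.Nullary.Decidable using (Dec; yes; no; from-no)
open import Relation.Unary using (Pred; Decidable)
open Data.Nat.Solver.+-*-Solver using ()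
  renaming (solve to solve′; _:=_ to _:=′_; _:+_ to _:+′_; _:*_ to _:*′_; con to con′)
open ℚ-Solver.+-*-Solver using (solve; _:=_; _:+_; _:*_; _:-_; :-_; con)

-- Eligibility by itself keeps the uses of a block at or below its target; the bound from the other
-- side needs a potential. For fixed `b`, the debt is the sum of target minus uses over the blocks
-- with index at most `b`. Choosing one of these blocks lowers the debt by 1. Choosing another
-- block, or none, means that none of them is eligible, because the least eligible index wins; then
-- the debt is at most `b + 1`. A block of length l delays the next choice by l positions, and
-- meanwhile each of the `b + 1` targets grows by at most 1/q_j per position. The active blocks are
-- so few and short compared with q_j that this growth totals at most 1, so the debt stays below a
-- constant depending on `b`.
--
-- The upper bound on occurrences rests on two facts. A default digit stands between any two
-- inserted blocks, so a late occurrence of B lies inside a single one. If that block is longer than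
-- B, its uses are bounded by Q_n^(k+1), and the stage condition leaves even the weighted sum of all
-- such uses smaller than Q_n^(k) by a factor that tends to infinity.

≤-induction : ∀ m (P : ℕ → Set) → P m → (∀ n → m ℕ.≤ n → P n → P (suc n)) → ∀ n → m ℕ.≤ n → P n
≤-induction m P base next zero    z≤n = base
≤-induction m P base next (suc n) m≤n with ℕ.m≤n⇒m<n∨m≡n m≤n
... | inj₁ (s≤s m≤n′) = next n m≤n′ (≤-induction m P base next n m≤n′)
... | inj₂ refl = base

-- Properties that hold from some index on

Eventually : (ℕ → Set) → Set
Eventually P = ∃[ m ] (∀ n → m ℕ.≤ n → P n)

eventually-map : ∀ {P R : ℕ → Set} → (∀ n → P n → R n) → Eventually P → Eventually R
eventually-map f (m , p) = m , λ n m≤n → f n (p n m≤n)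

eventually-× : ∀ {P R : ℕ → Set} → Eventually P → Eventually R → Eventually (λ n → P n × R n)
eventually-× (m , p) (m′ , r) = m ℕ.+ m′ , λ n ≤n →
  p n (ℕ.m+n≤o⇒m≤o m ≤n) , r n (ℕ.m+n≤o⇒n≤o m ≤n)

eventually-∀< : ∀ {P : ℕ → ℕ → Set} → (∀ k → Eventually (P k)) →
  ∀ K → Eventually (λ n → ∀ k → k ℕ.< K → P k n)
eventually-∀< p zero = 0 , λ _ _ _ ()
eventually-∀< {P} p (suc K) = eventually-map extend (eventually-× (eventually-∀< p K) (p K))
  where
  extend : ∀ n → (∀ k → k ℕ.< K → P k n) × P K n → ∀ k → k ℕ.< suc K → P k n
  extend n (f , g) k (s≤s k≤K) with ℕ.m≤n⇒m<n∨m≡n k≤K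
  ... | inj₁ k<K  = f k k<K
  ... | inj₂ refl = g

least<? : {P : Pred ℕ 0ℓ} → Decidable P → ∀ n →
  (∃[ c ] (c ℕ.< n × P c × (∀ d → d ℕ.< c → ¬ P d))) ⊎ (∀ d → d ℕ.< n → ¬ P d)
least<? P? zero = inj₂ λ _ ()
least<? {P} P? (suc n) with least<? P? n
... | inj₁ (c , c<n , pc , min) = inj₁ (c , ℕ.m<n⇒m<1+n c<n , pc , min)
... | inj₂ none with P? n
...   | yes pn = inj₁ (n , ℕ.n<1+n n , pn , none)
...   | no ¬pn = inj₂ none′
  where
  none′ : ∀ d → d ℕ.< suc n → ¬ P d
  none′ d (s≤s d≤n) with ℕ.m≤n⇒m<n∨m≡n d≤n
  ... | inj₁ d<n  = none d d<n
  ... | inj₂ refl = ¬pn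

-- A diagonal sequence: it moves on to the next stage as soon as that stage is safe forever.
module Stage (G : ℕ → ℕ → Set) (G-zero : ∀ n → G 0 n) (G-eventually : ∀ a → Eventually (G a)) where

  private
    threshold : ℕ → ℕ
    threshold a = proj₁ (G-eventually a)

    advance : ∀ n a → (∀ j → n ℕ.≤ j → G a j) →
      ∃[ b ] (a ℕ.≤ b × (∀ j → n ℕ.≤ j → G b j) × (threshold (suc a) ℕ.≤ n → suc a ℕ.≤ b))
    advance n a safe with threshold (suc a) ℕ.≤? n
    ... | yes t≤n = suc a , ℕ.n≤1+n a ,
          (λ j n≤j → proj₂ (G-eventually (suc a)) j (ℕ.≤-trans t≤n n≤j)) , λ _ → ℕ.≤-refl
    ... | no  t≰n = a , ℕ.≤-refl , safe , λ t≤n → ⊥-elim (t≰n t≤n)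

    safeStage : ∀ n → ∃[ a ] (∀ j → n ℕ.≤ j → G a j)
    successor : ∀ n → ∃[ b ] (proj₁ (safeStage n) ℕ.≤ b × (∀ j → suc n ℕ.≤ j → G b j) ×
      (threshold (suc (proj₁ (safeStage n))) ℕ.≤ suc n → suc (proj₁ (safeStage n)) ℕ.≤ b))
    safeStage zero    = 0 , λ j _ → G-zero j
    safeStage (suc n) = proj₁ (successor n) , proj₁ (proj₂ (proj₂ (successor n)))
    successor n = advance (suc n) (proj₁ (safeStage n)) λ j n<j → proj₂ (safeStage n) j (ℕ.<⇒≤ n<j)

  stage : ℕ → ℕ
  stage n = proj₁ (safeStage n)

  stage-good : ∀ n → G (stage n) n
  stage-good n = proj₂ (safeStage n) n ℕ.≤-refl

  stage-mono : ∀ {m n} → m ℕ.≤ n → stage m ℕ.≤ stage n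
  stage-mono {m} {n} = ≤-induction m (λ n → stage m ℕ.≤ stage n) ℕ.≤-refl
    (λ n _ le → ℕ.≤-trans le (proj₁ (proj₂ (successor n)))) n

  stage-unbounded : ∀ m → Eventually (λ n → m ℕ.≤ stage n)
  stage-unbounded zero = 0 , λ _ _ → z≤n
  stage-unbounded (suc m) = suc t , λ n t<n → ℕ.≤-trans reached (stage-mono t<n)
    where
    s = proj₁ (stage-unbounded m)
    t = s ℕ.+ threshold (suc m)
    reached : suc m ℕ.≤ stage (suc t)
    reached with ℕ.m≤n⇒m<n∨m≡n (proj₂ (stage-unbounded m) t (ℕ.m≤m+n s _))
    ... | inj₁ m<a = ℕ.≤-trans m<a (proj₁ (proj₂ (successor t)))
    ... | inj₂ m≡a = subst (λ z → suc z ℕ.≤ stage (suc t)) (sym m≡a)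
          (proj₂ (proj₂ (proj₂ (successor t))) (subst (λ z → threshold (suc z) ℕ.≤ suc t) m≡a
            (ℕ.≤-trans (ℕ.m≤n+m _ s) (ℕ.n≤1+n t))))

-- An enumeration of the non-empty blocks

-- A block d₁ ⋯ dₘ is the bijective binary numeral 1^d₁ 0 1^d₂ 0 ⋯ 0 1^dₘ, with 2[1+_] for 1 and 1+[2_] for 0.

decode : ℕᵇ → List⁺ ℕ
decode 0ᵇ       = 0 ∷ []
decode 2[1+ x ] = suc (List⁺.head (decode x)) ∷ List⁺.tail (decode x)
decode 1+[2 x ] = 0 ∷ toList (decode x)

encode : ℕ → List ℕ → ℕᵇ
encode zero    []      = 0ᵇ
encode zero    (d ∷ l) = 1+[2 encode d l ]
encode (suc h) l       = 2[1+ encode h l ]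

decode-encode : ∀ h l → decode (encode h l) ≡ h ∷ l
decode-encode zero    []      = refl
decode-encode zero    (d ∷ l) = cong (λ b → 0 ∷ toList b) (decode-encode d l)
decode-encode (suc h) l       rewrite decode-encode h l = refl

encode-decode : ∀ x → encode (List⁺.head (decode x)) (List⁺.tail (decode x)) ≡ x
encode-decode 0ᵇ       = refl
encode-decode 2[1+ x ] = cong 2[1+_] (encode-decode x)
encode-decode 1+[2 x ] = cong 1+[2_] (encode-decode x)

block : ℕ → List ℕ
block c = toList (decode (fromℕ c))

index : ℕ → List ℕ → ℕ
index h l = ℕᵇ-toℕ (encode h l)

block-index : ∀ h l → block (index h l) ≡ h ∷ l
block-index h l = cong toList
  (trans (cong decode (fromℕ-toℕ (encode h l))) (decode-encode h l))

-- Injectivity of the enumeration: all uses of a block are recorded under one index, so a block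
-- equal to B is counted under the index of B.
index-block : ∀ c {h l} → block c ≡ h ∷ l → c ≡ index h l
index-block c refl = sym (trans (cong ℕᵇ-toℕ (encode-decode (fromℕ c))) (toℕ-fromℕ c))

-- Rationals and finite sums

-- Turns an inequality into a ring identity between two differences, which `solve` can then
-- discharge.
difference-≤ : ∀ {a b x y} → a ℚ.≤ b → y ℚ.- x ≡ b ℚ.- a → x ℚ.≤ y
difference-≤ {a} {b} {x} {y} a≤b e = begin
  x                 ≡⟨ solve 2 (λ a x → x := a :+ (x :- a)) refl a x ⟩
  a ℚ.+ (x ℚ.- a)   ≤⟨ ℚ.+-monoˡ-≤ (x ℚ.- a) a≤b ⟩
  b ℚ.+ (x ℚ.- a)   ≡⟨ solve 3 (λ a b x → b :+ (x :- a) := x :+ (b :- a)) refl a b x ⟩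
  x ℚ.+ (b ℚ.- a)   ≡⟨ cong (x ℚ.+_) e ⟨
  x ℚ.+ (y ℚ.- x)   ≡⟨ solve 2 (λ x y → x :+ (y :- x) := y) refl x y ⟩
  y                 ∎
  where open ℚ.≤-Reasoning

-- Opaque, so that `ι n` stays an atom for the ring solver; `ι≡` leads back to the fractions in the
-- definitions.
opaque
  ι : ℕ → ℚ
  ι n = + n ℚ./ 1

  ιᵘ : ∀ n → ℚ.toℚᵘ (ι n) ℚᵘ.≃ ℚᵘ.mkℚᵘ (+ n) 0
  ιᵘ n = ℚ.toℚᵘ-fromℚᵘ (ℚᵘ.mkℚᵘ (+ n) 0)

  ι-+ : ∀ m n → ι (m ℕ.+ n) ≡ ι m ℚ.+ ι n
  ι-+ m n = ℚ.toℚᵘ-injective (begin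
    ℚ.toℚᵘ (ι (m ℕ.+ n))  ≈⟨ ιᵘ (m ℕ.+ n) ⟩
    ℚᵘ.mkℚᵘ (+ (m ℕ.+ n)) 0
      ≈⟨ ℚᵘ.*≡* (cong (ℤ._* + 1) (sym (cong₂ ℤ._+_ (ℤ.*-identityʳ (+ m)) (ℤ.*-identityʳ (+ n))))) ⟩
    ℚᵘ.mkℚᵘ (+ m) 0 ℚᵘ.+ ℚᵘ.mkℚᵘ (+ n) 0  ≈⟨ ℚᵘ.+-cong (ιᵘ m) (ιᵘ n) ⟨
    ℚ.toℚᵘ (ι m) ℚᵘ.+ ℚ.toℚᵘ (ι n)   ≈⟨ ℚ.toℚᵘ-homo-+ (ι m) (ι n) ⟨
    ℚ.toℚᵘ (ι m ℚ.+ ι n) ∎)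
    where open ℚᵘ.≃-Reasoning

  ι-* : ∀ m n → ι (m ℕ.* n) ≡ ι m ℚ.* ι n
  ι-* m n = ℚ.toℚᵘ-injective (begin
    ℚ.toℚᵘ (ι (m ℕ.* n))  ≈⟨ ιᵘ (m ℕ.* n) ⟩
    ℚᵘ.mkℚᵘ (+ (m ℕ.* n)) 0  ≈⟨ ℚᵘ.*≡* (cong (ℤ._* + 1) (ℤ.pos-* m n)) ⟩
    ℚᵘ.mkℚᵘ (+ m) 0 ℚᵘ.* ℚᵘ.mkℚᵘ (+ n) 0  ≈⟨ ℚᵘ.*-cong (ιᵘ m) (ιᵘ n) ⟨
    ℚ.toℚᵘ (ι m) ℚᵘ.* ℚ.toℚᵘ (ι n)   ≈⟨ ℚ.toℚᵘ-homo-* (ι m) (ι n) ⟨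
    ℚ.toℚᵘ (ι m ℚ.* ι n) ∎)
    where open ℚᵘ.≃-Reasoning

  0≤ι : ∀ n → 0ℚ ℚ.≤ ι n
  0≤ι n = ℚ.nonNegative⁻¹ (ι n) {{ℚ.normalize-nonNeg n 1}}

  ι-zero : ι 0 ≡ 0ℚ
  ι-zero = refl

  ι-one : ι 1 ≡ 1ℚ
  ι-one = refl

  ι≡ : ∀ n → ι n ≡ + n ℚ./ 1
  ι≡ n = refl

  1/-inverse : ∀ n .{{_ : ℕ.NonZero n}} → (+ 1 ℚ./ n) ℚ.* ι n ≡ 1ℚ
  1/-inverse (suc n) = ℚ.toℚᵘ-injective (begin
    ℚ.toℚᵘ ((+ 1 ℚ./ suc n) ℚ.* ι (suc n))  ≈⟨ ℚ.toℚᵘ-homo-* (+ 1 ℚ./ suc n) (ι (suc n)) ⟩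
    ℚ.toℚᵘ (+ 1 ℚ./ suc n) ℚᵘ.* ℚ.toℚᵘ (ι (suc n))
      ≈⟨ ℚᵘ.*-cong (ℚ.toℚᵘ-fromℚᵘ (ℚᵘ.mkℚᵘ (+ 1) n)) (ιᵘ (suc n)) ⟩
    ℚᵘ.mkℚᵘ (+ 1) n ℚᵘ.* ℚᵘ.mkℚᵘ (+ (suc n)) 0
      ≈⟨ ℚᵘ.*≡* (trans (ℤ.*-identityʳ _) (cong (ℤ._*_ (+ 1)) (cong +_ (sym (ℕ.*-identityʳ (suc n)))))) ⟩
    ℚᵘ.mkℚᵘ (+ 1) 0 ∎)
    where open ℚᵘ.≃-Reasoning

ι-suc : ∀ n → ι (suc n) ≡ 1ℚ ℚ.+ ι n
ι-suc n = trans (ι-+ 1 n) (cong (ℚ._+ ι n) ι-one)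

ι-mono : ∀ {m n} → m ℕ.≤ n → ι m ℚ.≤ ι n
ι-mono {m} {n} m≤n = subst (ι m ℚ.≤_) (trans (sym (ι-+ m (n ℕ.∸ m))) (cong ι (ℕ.m+[n∸m]≡n m≤n)))
  (difference-≤ (0≤ι (n ℕ.∸ m)) (solve 2 (λ a b → a :+ b :- a := b :- con 0ℚ) refl (ι m) (ι (n ℕ.∸ m))))

ι-cancel-< : ∀ {m n} → ι m ℚ.< ι n → m ℕ.< n
ι-cancel-< {m} {n} lt with m ℕ.<? n
... | yes m<n = m<n
... | no  m≮n = ⊥-elim (ℚ.<-irrefl refl (ℚ.<-≤-trans lt (ι-mono (ℕ.≮⇒≥ m≮n))))

*-monoˡ-≤ : ∀ {r a b} → 0ℚ ℚ.≤ r → a ℚ.≤ b → r ℚ.* a ℚ.≤ r ℚ.* b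
*-monoˡ-≤ {r} 0≤r = ℚ.*-monoˡ-≤-nonNeg r {{ℚ.nonNegative 0≤r}}

*-monoʳ-≤ : ∀ {r a b} → 0ℚ ℚ.≤ r → a ℚ.≤ b → a ℚ.* r ℚ.≤ b ℚ.* r
*-monoʳ-≤ {r} 0≤r = ℚ.*-monoʳ-≤-nonNeg r {{ℚ.nonNegative 0≤r}}

0≤* : ∀ {a b} → 0ℚ ℚ.≤ a → 0ℚ ℚ.≤ b → 0ℚ ℚ.≤ a ℚ.* b
0≤* {a} {b} 0≤a 0≤b = subst (ℚ._≤ a ℚ.* b) (ℚ.*-zeroʳ a) (*-monoˡ-≤ 0≤a 0≤b)

0≤1 : 0ℚ ℚ.≤ 1ℚ
0≤1 = ℚ.nonNegative⁻¹ 1ℚ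

∑-mono : ∀ f g n → (∀ i → i ℕ.< n → f i ℚ.≤ g i) → ∑ f n ℚ.≤ ∑ g n
∑-mono f g zero    f≤g = ℚ.≤-refl
∑-mono f g (suc n) f≤g =
  ℚ.+-mono-≤ (∑-mono f g n λ i i<n → f≤g i (ℕ.m<n⇒m<1+n i<n)) (f≤g n (ℕ.n<1+n n))

∑-mono-+ : ∀ f g r n → (∀ i → i ℕ.< n → f i ℚ.≤ g i ℚ.+ r) → ∑ f n ℚ.≤ ∑ g n ℚ.+ ι n ℚ.* r
∑-mono-+ f g r zero f≤g rewrite ι-zero = ℚ.≤-reflexive (solve 1 (λ r → con 0ℚ := con 0ℚ :+ con 0ℚ :* r) refl r)
∑-mono-+ f g r (suc n) f≤g = begin
  ∑ f n ℚ.+ f n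
    ≤⟨ ℚ.+-mono-≤ (∑-mono-+ f g r n λ i i<n → f≤g i (ℕ.m<n⇒m<1+n i<n)) (f≤g n (ℕ.n<1+n n)) ⟩
  (∑ g n ℚ.+ ι n ℚ.* r) ℚ.+ (g n ℚ.+ r)
    ≡⟨ solve 4 (λ a b n r → (a :+ n :* r) :+ (b :+ r) := (a :+ b) :+ (con 1ℚ :+ n) :* r) refl
         (∑ g n) (g n) (ι n) r ⟩
  ∑ g (suc n) ℚ.+ (1ℚ ℚ.+ ι n) ℚ.* r
    ≡⟨ cong (λ z → ∑ g (suc n) ℚ.+ z ℚ.* r) (ι-suc n) ⟨
  ∑ g (suc n) ℚ.+ ι (suc n) ℚ.* r ∎
  where open ℚ.≤-Reasoning

-- Used for the debt: every summand may grow by `r`, but the block just chosen gains one use and its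
-- summand loses 1.
∑-mono-drop : ∀ f g r n c → c ℕ.< n → (∀ i → i ℕ.< n → f i ℚ.≤ g i ℚ.+ r) →
  f c ℚ.≤ g c ℚ.+ r ℚ.- 1ℚ → ∑ f n ℚ.≤ ∑ g n ℚ.+ ι n ℚ.* r ℚ.- 1ℚ
∑-mono-drop f g r (suc n) c (s≤s c≤n) f≤g drop = begin
  ∑ f n ℚ.+ f n
    ≤⟨ total ⟩
  ((∑ g n ℚ.+ ι n ℚ.* r) ℚ.+ (g n ℚ.+ r)) ℚ.- 1ℚ
    ≡⟨ solve 4 (λ a b n r → (a :+ n :* r) :+ (b :+ r) :- con 1ℚ := (a :+ b) :+ (con 1ℚ :+ n) :* r :- con 1ℚ) refl
         (∑ g n) (g n) (ι n) r ⟩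
  ∑ g (suc n) ℚ.+ (1ℚ ℚ.+ ι n) ℚ.* r ℚ.- 1ℚ
    ≡⟨ cong (λ z → ∑ g (suc n) ℚ.+ z ℚ.* r ℚ.- 1ℚ) (ι-suc n) ⟨
  ∑ g (suc n) ℚ.+ ι (suc n) ℚ.* r ℚ.- 1ℚ ∎
  where
  open ℚ.≤-Reasoning
  f≤g′ : ∀ i → i ℕ.< n → f i ℚ.≤ g i ℚ.+ r
  f≤g′ i i<n = f≤g i (ℕ.m<n⇒m<1+n i<n)
  total : ∑ f n ℚ.+ f n ℚ.≤ ((∑ g n ℚ.+ ι n ℚ.* r) ℚ.+ (g n ℚ.+ r)) ℚ.- 1ℚ
  total with ℕ.m≤n⇒m<n∨m≡n c≤n
  ... | inj₁ c<n = ℚ.≤-trans (ℚ.+-mono-≤ (∑-mono-drop f g r n c c<n f≤g′ drop) (f≤g n (ℕ.n<1+n n)))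
      (ℚ.≤-reflexive (solve 2 (λ a b → (a :- con 1ℚ) :+ b := (a :+ b) :- con 1ℚ) refl
        (∑ g n ℚ.+ ι n ℚ.* r) (g n ℚ.+ r)))
  ... | inj₂ refl = ℚ.≤-trans (ℚ.+-mono-≤ (∑-mono-+ f g r n f≤g′) drop)
      (ℚ.≤-reflexive (solve 2 (λ a b → a :+ (b :- con 1ℚ) := (a :+ b) :- con 1ℚ) refl
        (∑ g n ℚ.+ ι n ℚ.* r) (g n ℚ.+ r)))

∑-term : ∀ f n c → c ℕ.< n → (∀ i → i ℕ.< n → 0ℚ ℚ.≤ f i) → f c ℚ.≤ ∑ f n
∑-term f (suc n) c (s≤s c≤n) 0≤f with ℕ.m≤n⇒m<n∨m≡n c≤n
... | inj₁ c<n = ℚ.≤-trans (∑-term f n c c<n λ i i<n → 0≤f i (ℕ.m<n⇒m<1+n i<n))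
      (difference-≤ (0≤f n (ℕ.n<1+n n)) (solve 2 (λ a b → a :+ b :- a := b :- con 0ℚ) refl (∑ f n) (f n)))
... | inj₂ refl = difference-≤ (0≤∑ n λ i i<n → 0≤f i (ℕ.m<n⇒m<1+n i<n))
      (solve 2 (λ a b → a :+ b :- b := a :- con 0ℚ) refl (∑ f n) (f n))
  where
  0≤∑ : ∀ n → (∀ i → i ℕ.< n → 0ℚ ℚ.≤ f i) → 0ℚ ℚ.≤ ∑ f n
  0≤∑ zero    _ = ℚ.≤-refl
  0≤∑ (suc n) p = ℚ.+-mono-≤ (0≤∑ n λ i i<n → p i (ℕ.m<n⇒m<1+n i<n)) (p n (ℕ.n<1+n n))

∑ℕ : (ℕ → ℕ) → ℕ → ℕ
∑ℕ f zero    = 0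
∑ℕ f (suc n) = ∑ℕ f n ℕ.+ f n

∑ℕ-mono-≤ : ∀ f {m n} → m ℕ.≤ n → ∑ℕ f m ℕ.≤ ∑ℕ f n
∑ℕ-mono-≤ f {n = zero}  z≤n = z≤n
∑ℕ-mono-≤ f {m} {suc n} m≤n with ℕ.m≤n⇒m<n∨m≡n m≤n
... | inj₁ (s≤s m≤n′) = ℕ.≤-trans (∑ℕ-mono-≤ f m≤n′) (ℕ.m≤m+n _ _)
... | inj₂ refl = ℕ.≤-refl

∑ℕ-term : ∀ f {c n} → c ℕ.< n → f c ℕ.≤ ∑ℕ f n
∑ℕ-term f {c} c<n = ℕ.≤-trans (ℕ.m≤n+m (f c) (∑ℕ f c)) (∑ℕ-mono-≤ f c<n)

∑ℕ-mono : ∀ f g n → (∀ i → f i ℕ.≤ g i) → ∑ℕ f n ℕ.≤ ∑ℕ g n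
∑ℕ-mono f g zero    f≤g = z≤n
∑ℕ-mono f g (suc n) f≤g = ℕ.+-mono-≤ (∑ℕ-mono f g n f≤g) (f≤g n)

∑ℕ-mono-rise : ∀ f g n c d → c ℕ.< n → (∀ i → f i ℕ.≤ g i) → d ℕ.+ f c ℕ.≤ g c →
  d ℕ.+ ∑ℕ f n ℕ.≤ ∑ℕ g n
∑ℕ-mono-rise f g (suc n) c d (s≤s c≤n) f≤g rise with ℕ.m≤n⇒m<n∨m≡n c≤n
... | inj₁ c<n = ℕ.≤-trans (ℕ.≤-reflexive (sym (ℕ.+-assoc d (∑ℕ f n) (f n))))
      (ℕ.+-mono-≤ (∑ℕ-mono-rise f g n c d c<n f≤g rise) (f≤g n))
... | inj₂ refl = ℕ.≤-trans (ℕ.≤-reflexive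
      (trans (sym (ℕ.+-assoc d (∑ℕ f n) (f n)))
        (trans (cong (ℕ._+ f n) (ℕ.+-comm d (∑ℕ f n))) (ℕ.+-assoc (∑ℕ f n) d (f n)))))
      (ℕ.+-mono-≤ (∑ℕ-mono f g n f≤g) rise)

∑ℕ-scaled : ∀ f g r n → (∀ i → i ℕ.< n → ι (f i) ℚ.≤ ι (g i) ℚ.* r) → ι (∑ℕ f n) ℚ.≤ ι (∑ℕ g n) ℚ.* r
∑ℕ-scaled f g r zero    _ rewrite ι-zero = ℚ.≤-reflexive (sym (ℚ.*-zeroˡ r))
∑ℕ-scaled f g r (suc n) f≤g = begin
  ι (∑ℕ f n ℕ.+ f n)      ≡⟨ ι-+ (∑ℕ f n) (f n) ⟩
  ι (∑ℕ f n) ℚ.+ ι (f n)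
    ≤⟨ ℚ.+-mono-≤ (∑ℕ-scaled f g r n λ i i<n → f≤g i (ℕ.m<n⇒m<1+n i<n)) (f≤g n (ℕ.n<1+n n)) ⟩
  ι (∑ℕ g n) ℚ.* r ℚ.+ ι (g n) ℚ.* r ≡⟨ ℚ.*-distribʳ-+ r (ι (∑ℕ g n)) (ι (g n)) ⟨
  (ι (∑ℕ g n) ℚ.+ ι (g n)) ℚ.* r ≡⟨ cong (ℚ._* r) (ι-+ (∑ℕ g n) (g n)) ⟨
  ι (∑ℕ g n ℕ.+ g n) ℚ.* r ∎
  where open ℚ.≤-Reasoning

-- Counting positions, block weights and occurrences inside a list

count-suc : {P : Pred ℕ 0ℓ} (P? : Decidable P) → ∀ n →
  count P? (suc n) ≡ count P? n ℕ.+ length (filter P? (n ∷ []))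
count-suc P? n = trans (cong (λ l → length (filter P? l)) (sym (upTo-∷ʳ n)))
  (trans (cong length (filter-++ P? (upTo n) (n ∷ []))) (length-++ (filter P? (upTo n))))

count-suc-yes : {P : Pred ℕ 0ℓ} (P? : Decidable P) → ∀ n → P n → count P? (suc n) ≡ suc (count P? n)
count-suc-yes P? n pn = trans (count-suc P? n)
  (trans (cong (λ l → count P? n ℕ.+ length l) (filter-accept P? pn)) (ℕ.+-comm (count P? n) 1))

count-suc-no : {P : Pred ℕ 0ℓ} (P? : Decidable P) → ∀ n → ¬ P n → count P? (suc n) ≡ count P? n
count-suc-no P? n ¬pn = trans (count-suc P? n)
  (trans (cong (λ l → count P? n ℕ.+ length l) (filter-reject P? ¬pn)) (ℕ.+-identityʳ _))

count≤ : {P : Pred ℕ 0ℓ} (P? : Decidable P) → ∀ n → count P? n ℕ.≤ n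
count≤ P? n = ℕ.≤-trans (length-filter P? (upTo n)) (ℕ.≤-reflexive (length-upTo n))

opaque
  inv : ℕ → ℚ
  inv m = + 1 ℚ./ suc m

  0≤inv : ∀ m → 0ℚ ℚ.≤ inv m
  0≤inv m = ℚ.nonNegative⁻¹ (inv m) {{ℚ.normalize-nonNeg 1 (suc m)}}

  inv-ι : ∀ m → inv m ℚ.* ι (suc m) ≡ 1ℚ
  inv-ι m = 1/-inverse (suc m)

-- Each digit d contributes d + 1, so one number bounds both the length of the block and all its
-- digits.
weight : ℕ → ℕ
weight c = sum (map suc (block c))

totalWeight : ℕ → ℕ
totalWeight = ∑ℕ weight

length≤weight : ∀ (l : List ℕ) → length l ℕ.≤ sum (map suc l)
length≤weight []      = z≤n
length≤weight (d ∷ l) = s≤s (ℕ.≤-trans (length≤weight l) (ℕ.m≤n+m _ d))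

digits≤weight : ∀ (l : List ℕ) → All (ℕ._≤ sum (map suc l)) l
digits≤weight []      = []
digits≤weight (d ∷ l) = ℕ.≤-trans (ℕ.n≤1+n d) (ℕ.m≤m+n (suc d) _) ∷
  All.map (λ d≤ → ℕ.≤-trans d≤ (ℕ.m≤n+m _ (suc d))) (digits≤weight l)

indicator : {P : Set} → Dec P → ℕ
indicator (yes _) = 1
indicator (no _)  = 0

module _ (β : List ℕ) where

  -- Occurrences of `β` inside a list. Near the end `take` returns fewer than `length β` digits, so
  -- an occurrence never runs over the end.
  hits : List ℕ → ℕ
  hits []      = 0
  hits (d ∷ r) = indicator (≡-dec ℕ._≟_ (take (length β) (d ∷ r)) β) ℕ.+ hits r

  hits-accept : ∀ d r → take (length β) (d ∷ r) ≡ β → hits (d ∷ r) ≡ suc (hits r)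
  hits-accept d r e with ≡-dec ℕ._≟_ (take (length β) (d ∷ r)) β
  ... | yes _ = refl
  ... | no ¬e = ⊥-elim (¬e e)

  hits≤hits-∷ : ∀ d r → hits r ℕ.≤ hits (d ∷ r)
  hits≤hits-∷ d r = ℕ.m≤n+m (hits r) _

  hits≤length : ∀ r → hits r ℕ.≤ length r
  hits≤length [] = z≤n
  hits≤length (d ∷ r) with ≡-dec ℕ._≟_ (take (length β) (d ∷ r)) β
  ... | yes _ = s≤s (hits≤length r)
  ... | no _  = ℕ.m≤n⇒m≤1+n (hits≤length r)

  hits-zero : ∀ r → length r ℕ.≤ length β → r ≢ β → hits r ≡ 0
  hits-zero [] _ _ = refl
  hits-zero (d ∷ r) r≤β r≢β with ≡-dec ℕ._≟_ (take (length β) (d ∷ r)) β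
  ... | yes e = ⊥-elim (r≢β (trans (sym (take-all (length β) (d ∷ r) r≤β)) e))
  -- The tail is strictly shorter than `β`, hence differs from it.
  ... | no _  = hits-zero r (ℕ.<⇒≤ r≤β) λ { refl → ℕ.<-irrefl refl r≤β }

  hits≤1 : ∀ r → length r ℕ.≤ length β → hits r ℕ.≤ 1
  hits≤1 [] _ = z≤n
  hits≤1 (d ∷ r) r≤β rewrite hits-zero r (ℕ.<⇒≤ r≤β) (λ { refl → ℕ.<-irrefl refl r≤β })
    with ≡-dec ℕ._≟_ (take (length β) (d ∷ r)) β
  ... | yes _ = ℕ.≤-refl
  ... | no _  = z≤n

  -- A block that is not longer than β contains β only if it equals β.
  longLength : ℕ → ℕ
  longLength c with length β ℕ.<? length (block c)
  ... | yes _ = length (block c)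
  ... | no  _ = 0

∑-≤1 : ∀ f n → (∀ i → i ℕ.< n → f i ℚ.≤ 1ℚ) → ∑ f n ℚ.≤ ι n
∑-≤1 f zero    _ = ℚ.≤-reflexive (sym ι-zero)
∑-≤1 f (suc n) f≤1 = ℚ.≤-trans (ℚ.+-mono-≤ (∑-≤1 f n λ i i<n → f≤1 i (ℕ.m<n⇒m<1+n i<n)) (f≤1 n (ℕ.n<1+n n)))
  (ℚ.≤-reflexive (trans (ℚ.+-comm (ι n) 1ℚ) (sym (ι-suc n))))

window : (ℕ → ℕ) → ℕ → ∀ k → Vec ℕ k
window E i k = tabulate (λ j → E (i ℕ.+ toℕ j))

window-suc : ∀ E i k → window E i (suc k) ≡ E i ∷ window E (suc i) k
window-suc E i k = cong₂ _∷_ (cong E (ℕ.+-identityʳ i)) (Vec.tabulate-cong λ j → cong E (ℕ.+-suc i (toℕ j)))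

∣p-q∣≤ : ∀ {p q r} → p ℚ.≤ q ℚ.+ r → q ℚ.≤ p ℚ.+ r → ℚ.∣ p ℚ.- q ∣ ℚ.≤ r
∣p-q∣≤ {p} {q} {r} p≤ q≤ with ℚ.∣p∣≡p∨∣p∣≡-p (p ℚ.- q)
... | inj₁ e = ℚ.≤-trans (ℚ.≤-reflexive e)
      (difference-≤ p≤ (solve 3 (λ p q r → r :- (p :- q) := (q :+ r) :- p) refl p q r))
... | inj₂ e = ℚ.≤-trans (ℚ.≤-reflexive e)
      (difference-≤ q≤ (solve 3 (λ p q r → r :- (:- (p :- q)) := (p :+ r) :- q) refl p q r))

scaled-bound : ∀ η .{{_ : ℚ.Positive η}} C {p} →
  C ℚ.* (ℚ.1/ η) {{ℚ.pos⇒nonZero η}} ℚ.≤ p → C ℚ.≤ η ℚ.* p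
scaled-bound η C {p} le = begin
  C                      ≡⟨ ℚ.*-identityʳ C ⟨
  C ℚ.* 1ℚ               ≡⟨ cong (C ℚ.*_) (ℚ.*-inverseˡ η {{η≢0}}) ⟨
  C ℚ.* (1/η ℚ.* η)      ≡⟨ solve 3 (λ c i e → c :* (i :* e) := e :* (c :* i)) refl C 1/η η ⟩
  η ℚ.* (C ℚ.* 1/η)      ≤⟨ *-monoˡ-≤ (ℚ.<⇒≤ (ℚ.positive⁻¹ η)) le ⟩
  η ℚ.* p ∎
  where
  open ℚ.≤-Reasoning
  η≢0 = ℚ.pos⇒nonZero η
  1/η = (ℚ.1/ η) {{η≢0}}

double : ∀ p → p ℚ.+ p ≡ ι 2 ℚ.* p
double p = begin
  p ℚ.+ p                     ≡⟨ solve 1 (λ a → a :+ a := (con 1ℚ :+ con 1ℚ) :* a) refl p ⟩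
  (1ℚ ℚ.+ 1ℚ) ℚ.* p           ≡⟨ cong (λ z → (1ℚ ℚ.+ z) ℚ.* p) ι-one ⟨
  (1ℚ ℚ.+ ι 1) ℚ.* p          ≡⟨ cong (ℚ._* p) (ι-suc 1) ⟨
  ι 2 ℚ.* p ∎
  where open ≡-Reasoning

0<ι-suc : ∀ n → 0ℚ ℚ.< ι (suc n)
0<ι-suc n = subst (0ℚ ℚ.<_) (sym (ι-suc n)) (ℚ.+-mono-<-≤ (ℚ.positive⁻¹ 1ℚ) (0≤ι n))

-- The greedy construction

module Construction
  (q : ℕ → ℕ) (q≥2 : ∀ n → 2 ℕ.≤ q n)
  (recip : ℕ → ℕ → ℚ)
  (recip-zero : ∀ i → recip i 0 ≡ 1ℚ)
  (recip-step : ∀ i k → recip i (suc k) ℚ.* ι (q (i ℕ.+ k)) ≡ recip i k)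
  (0≤recip : ∀ i k → 0ℚ ℚ.≤ recip i k)
  where

  -- Size of the reciprocals and of their sums

  Q⟨_⟩ : ℕ → ℕ → ℚ
  Q⟨ k ⟩ n = ∑ (λ i → recip i k) n

  recip-suc-≤ : ∀ i k m → m ℕ.≤ q (i ℕ.+ k) → ι m ℚ.* recip i (suc k) ℚ.≤ recip i k
  recip-suc-≤ i k m m≤q = begin
    ι m ℚ.* recip i (suc k)               ≤⟨ *-monoʳ-≤ (0≤recip i (suc k)) (ι-mono m≤q) ⟩
    ι (q (i ℕ.+ k)) ℚ.* recip i (suc k)   ≡⟨ ℚ.*-comm (ι (q (i ℕ.+ k))) (recip i (suc k)) ⟩
    recip i (suc k) ℚ.* ι (q (i ℕ.+ k))   ≡⟨ recip-step i k ⟩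
    recip i k ∎
    where open ℚ.≤-Reasoning

  recip-decreasing : ∀ i k → recip i (suc k) ℚ.≤ recip i k
  recip-decreasing i k = ℚ.≤-trans
    (ℚ.≤-reflexive (sym (trans (cong (ℚ._* recip i (suc k)) ι-one) (ℚ.*-identityˡ (recip i (suc k))))))
    (recip-suc-≤ i k 1 (ℕ.<⇒≤ (q≥2 (i ℕ.+ k))))

  recip-anti : ∀ i {k l} → k ℕ.≤ l → recip i l ℚ.≤ recip i k
  recip-anti i {k} {zero}  z≤n = ℚ.≤-refl
  recip-anti i {k} {suc l} k≤l with ℕ.m≤n⇒m<n∨m≡n k≤l
  ... | inj₁ (s≤s k≤l′) = ℚ.≤-trans (recip-decreasing i l) (recip-anti i k≤l′)
  ... | inj₂ refl = ℚ.≤-refl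

  recip≤inv : ∀ i k m → suc m ℕ.≤ q i → recip i (suc k) ℚ.≤ inv m
  recip≤inv i k m m<q = ℚ.≤-trans (recip-anti i {1} {suc k} (s≤s z≤n)) (begin
    recip i 1                          ≡⟨ ℚ.*-identityʳ (recip i 1) ⟨
    recip i 1 ℚ.* 1ℚ                   ≡⟨ cong (recip i 1 ℚ.*_) (inv-ι m) ⟨
    recip i 1 ℚ.* (inv m ℚ.* ι (suc m))
      ≡⟨ solve 3 (λ a b c → a :* (b :* c) := b :* (c :* a)) refl (recip i 1) (inv m) (ι (suc m)) ⟩
    inv m ℚ.* (ι (suc m) ℚ.* recip i 1)
      ≤⟨ *-monoˡ-≤ (0≤inv m) (subst (ι (suc m) ℚ.* recip i 1 ℚ.≤_) (recip-zero i)
           (recip-suc-≤ i 0 (suc m) (subst (λ z → suc m ℕ.≤ q z) (sym (ℕ.+-identityʳ i)) m<q))) ⟩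
    inv m ℚ.* 1ℚ                       ≡⟨ ℚ.*-identityʳ (inv m) ⟩
    inv m ∎)
    where open ℚ.≤-Reasoning

  0≤Q : ∀ k n → 0ℚ ℚ.≤ Q⟨ k ⟩ n
  0≤Q k zero    = ℚ.≤-refl
  0≤Q k (suc n) = ℚ.+-mono-≤ (0≤Q k n) (0≤recip n k)

  Q-suc-≤ : ∀ k n → Q⟨ k ⟩ n ℚ.≤ Q⟨ k ⟩ (suc n)
  Q-suc-≤ k n = difference-≤ (0≤recip n k)
    (solve 2 (λ a b → a :+ b :- a := b :- con 0ℚ) refl (Q⟨ k ⟩ n) (recip n k))

  Q-anti : ∀ {k l} n → k ℕ.≤ l → Q⟨ l ⟩ n ℚ.≤ Q⟨ k ⟩ n
  Q-anti {k} {l} n k≤l = ∑-mono (λ i → recip i l) (λ i → recip i k) n λ i _ → recip-anti i k≤l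

  module _
    (q-eventually : ∀ m → Eventually (λ j → m ℕ.≤ q j))
    (Q→∞ : ∀ k M → Eventually (λ n → M ℚ.< Q⟨ suc k ⟩ n))
    where

    -- Once q_j ≥ 2c, each new term of 2c Q_n^(k+2) is at most the new term of Q_n^(k+1). The
    -- earlier terms amount to a constant `M`, which the divergent Q_n^(k+1) eventually exceeds; the
    -- factor 2 absorbs it.
    Q-rare : ∀ c k → Eventually (λ n → ι c ℚ.* Q⟨ suc (suc k) ⟩ n ℚ.≤ Q⟨ suc k ⟩ n)
    Q-rare c k = s ℕ.+ t , bound
      where
      open ℚ.≤-Reasoning
      large = q-eventually (2 ℕ.* c)
      s = proj₁ large
      c₂ = ι (2 ℕ.* c)
      M = c₂ ℚ.* Q⟨ suc (suc k) ⟩ s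
      t = proj₁ (Q→∞ k M)
      tail : ∀ d → c₂ ℚ.* Q⟨ suc (suc k) ⟩ (s ℕ.+ d) ℚ.≤ M ℚ.+ Q⟨ suc k ⟩ (s ℕ.+ d)
      tail zero rewrite ℕ.+-identityʳ s = difference-≤ (0≤Q (suc k) s)
        (solve 2 (λ a b → a :+ b :- a := b :- con 0ℚ) refl M (Q⟨ suc k ⟩ s))
      tail (suc d) rewrite ℕ.+-suc s d = begin
        c₂ ℚ.* (Q⟨ suc (suc k) ⟩ (s ℕ.+ d) ℚ.+ recip (s ℕ.+ d) (suc (suc k)))
          ≡⟨ ℚ.*-distribˡ-+ c₂ (Q⟨ suc (suc k) ⟩ (s ℕ.+ d)) (recip (s ℕ.+ d) (suc (suc k))) ⟩
        c₂ ℚ.* Q⟨ suc (suc k) ⟩ (s ℕ.+ d) ℚ.+ c₂ ℚ.* recip (s ℕ.+ d) (suc (suc k))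
          ≤⟨ ℚ.+-mono-≤ (tail d) (recip-suc-≤ (s ℕ.+ d) (suc k) (2 ℕ.* c)
               (proj₂ large (s ℕ.+ d ℕ.+ suc k) (ℕ.≤-trans (ℕ.m≤m+n s d) (ℕ.m≤m+n _ (suc k))))) ⟩
        (M ℚ.+ Q⟨ suc k ⟩ (s ℕ.+ d)) ℚ.+ recip (s ℕ.+ d) (suc k)
          ≡⟨ ℚ.+-assoc M (Q⟨ suc k ⟩ (s ℕ.+ d)) (recip (s ℕ.+ d) (suc k)) ⟩
        M ℚ.+ (Q⟨ suc k ⟩ (s ℕ.+ d) ℚ.+ recip (s ℕ.+ d) (suc k)) ∎
      bound : ∀ n → s ℕ.+ t ℕ.≤ n → ι c ℚ.* Q⟨ suc (suc k) ⟩ n ℚ.≤ Q⟨ suc k ⟩ n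
      bound n s+t≤n = ℚ.*-cancelˡ-≤-pos (ι 2) {{ℚ.positive (0<ι-suc 1)}} (begin
        ι 2 ℚ.* (ι c ℚ.* Q⟨ suc (suc k) ⟩ n)
          ≡⟨ ℚ.*-assoc (ι 2) (ι c) (Q⟨ suc (suc k) ⟩ n) ⟨
        (ι 2 ℚ.* ι c) ℚ.* Q⟨ suc (suc k) ⟩ n
          ≡⟨ cong (ℚ._* Q⟨ suc (suc k) ⟩ n) (ι-* 2 c) ⟨
        c₂ ℚ.* Q⟨ suc (suc k) ⟩ n
          ≤⟨ subst (λ z → c₂ ℚ.* Q⟨ suc (suc k) ⟩ z ℚ.≤ M ℚ.+ Q⟨ suc k ⟩ z)
               (ℕ.m+[n∸m]≡n (ℕ.m+n≤o⇒m≤o s s+t≤n)) (tail (n ℕ.∸ s)) ⟩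
        M ℚ.+ Q⟨ suc k ⟩ n
          ≤⟨ ℚ.+-monoˡ-≤ (Q⟨ suc k ⟩ n) (ℚ.<⇒≤ (proj₂ (Q→∞ k M) n (ℕ.m+n≤o⇒n≤o s s+t≤n))) ⟩
        Q⟨ suc k ⟩ n ℚ.+ Q⟨ suc k ⟩ n
          ≡⟨ double (Q⟨ suc k ⟩ n) ⟩
        ι 2 ℚ.* Q⟨ suc k ⟩ n ∎)

    -- What position `j` must satisfy before the first `a` blocks may be active: `sparse` limits the
    -- growth of the targets while one block is written, `room` puts all block digits at or below
    -- the default digit, and `rare` makes occurrences inside longer blocks negligible.
    record Good (a j : ℕ) : Set where
      constructor good
      field
        sparse : suc (a ℕ.* suc (totalWeight a)) ℕ.≤ q j
        room   : suc (totalWeight a ℕ.+ totalWeight a) ℕ.≤ q j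
        rare   : ∀ k → k ℕ.< a →
          ι (a ℕ.* totalWeight a) ℚ.* Q⟨ suc (suc k) ⟩ j ℚ.≤ Q⟨ suc k ⟩ j

    good-zero : ∀ j → Good 0 j
    good-zero j = good 1≤q 1≤q λ _ ()
      where 1≤q = ℕ.<⇒≤ (q≥2 j)

    good-eventually : ∀ a → Eventually (Good a)
    good-eventually a = eventually-map (λ _ ((s , r) , t) → good s r t)
      (eventually-× (eventually-× (q-eventually _) (q-eventually _))
        (eventually-∀< (Q-rare (a ℕ.* totalWeight a)) a))

    module Schedule
      (stage : ℕ → ℕ)
      (stage-good : ∀ n → Good (stage n) n)
      (stage-mono : ∀ {m n} → m ℕ.≤ n → stage m ℕ.≤ stage n)
      (stage-unbounded : ∀ m → Eventually (λ n → m ℕ.≤ stage n))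
      where
      open Good

      -- The process that writes the digits

      half : ℕ → ℕ
      half n = ⌊ q n ℕ.∸ 1 /2⌋

      record State : Set where
        constructor _,_
        field
          pending : List ℕ
          used    : ℕ → ℕ

      open State

      bump : ℕ → (ℕ → ℕ) → ℕ → ℕ
      bump c u d with c ℕ.≟ d
      ... | yes _ = suc (u d)
      ... | no  _ = u d

      bump-≡ : ∀ c u → bump c u c ≡ suc (u c)
      bump-≡ c u with c ℕ.≟ c
      ... | yes _  = refl
      ... | no c≢c = ⊥-elim (c≢c refl)

      ≤bump : ∀ c u d → u d ℕ.≤ bump c u d
      ≤bump c u d with c ℕ.≟ d
      ... | yes _ = ℕ.n≤1+n (u d)
      ... | no  _ = ℕ.≤-refl

      target : ℕ → ℕ → ℚ
      target c = Q⟨ length (block c) ⟩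

      Eligible : ℕ → (ℕ → ℕ) → ℕ → Set
      Eligible n u c = ι (suc (u c)) ℚ.≤ target c n

      -- A relation beside the function `step`, so that invariants follow by cases on the kind of
      -- step. In `insert` the list is still empty at position `n`, which therefore carries the
      -- default digit; the block starts at `n + 1`. This is what separates consecutive blocks.
      data Step (n : ℕ) : State → State → Set where
        emit   : ∀ {d r u} → Step n (d ∷ r , u) (r , u)
        insert : ∀ {u} c → c ℕ.< stage n → Eligible n u c →
          (∀ d → d ℕ.< c → ¬ Eligible n u d) → Step n ([] , u) (block c , bump c u)
        idle   : ∀ {u} → (∀ d → d ℕ.< stage n → ¬ Eligible n u d) → Step n ([] , u) ([] , u)

      step : ∀ n s → Σ State (Step n s)
      step n (d ∷ r , u) = (r , u) , emit
      step n ([] , u) with least<? {P = Eligible n u} (λ c → ι (suc (u c)) ℚ.≤? target c n) (stage n)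
      ... | inj₁ (c , c<a , elig , least) = (block c , bump c u) , insert c c<a elig least
      ... | inj₂ none                     = ([] , u) , idle none

      state : ℕ → State
      state zero    = [] , λ _ → 0
      state (suc n) = proj₁ (step n (state n))

      state-step : ∀ n → Step n (state n) (state (suc n))
      state-step n = proj₂ (step n (state n))

      emitted : ℕ → List ℕ → ℕ
      emitted f []      = f
      emitted f (d ∷ _) = d

      digits : ℕ → ℕ
      digits n = emitted (half n) (pending (state n))

      invariant : (I : ℕ → State → Set) → I 0 (state 0) →
        (∀ n {s t} → Step n s t → I n s → I (suc n) t) → ∀ n → I n (state n)
      invariant I base next n = ≤-induction 0 (λ n → I n (state n)) base (λ n _ → next n (state-step n)) n z≤n

      weight≤stage : ∀ {c n j} → c ℕ.< stage n → n ℕ.≤ j → weight c ℕ.≤ totalWeight (stage j)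
      weight≤stage c<a n≤j = ℕ.≤-trans (∑ℕ-term weight c<a) (∑ℕ-mono-≤ weight (stage-mono n≤j))

      weight≤half : ∀ {c n} j → c ℕ.< stage n → n ℕ.≤ j → weight c ℕ.≤ half j
      weight≤half j c<a n≤j = ℕ.≤-trans (weight≤stage c<a n≤j)
        (ℕ.≤-trans (ℕ.≤-reflexive (ℕ.n≡⌊n+n/2⌋ _)) (ℕ.⌊n/2⌋-mono (ℕ.∸-monoˡ-≤ 1 (room (stage-good j)))))

      -- The bound is required at all later positions because a pending digit is emitted at some
      -- later `j` and `q` need not be monotone.
      pending-fits : ∀ n → All (λ d → ∀ j → n ℕ.≤ j → d ℕ.≤ half j) (pending (state n))
      pending-fits n = invariant (λ n s → All (λ d → ∀ j → n ℕ.≤ j → d ℕ.≤ half j) (pending s)) [] pres n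
        where
        pres : ∀ n {s t} → Step n s t →
          All (λ d → ∀ j → n ℕ.≤ j → d ℕ.≤ half j) (pending s) →
          All (λ d → ∀ j → suc n ℕ.≤ j → d ℕ.≤ half j) (pending t)
        pres n emit (_ ∷ fits) = All.map (λ d≤ j n<j → d≤ j (ℕ.<⇒≤ n<j)) fits
        pres n (insert c c<a _ _) _ = All.map (λ d≤ j n<j →
          ℕ.≤-trans d≤ (weight≤half j c<a (ℕ.<⇒≤ n<j))) (digits≤weight (block c))
        pres n (idle _) _ = []

      digits≤half : ∀ n → digits n ℕ.≤ half n
      digits≤half n with pending (state n) | pending-fits n
      ... | []    | _       = ℕ.≤-refl
      ... | d ∷ _ | d≤ ∷ _ = d≤ n ℕ.≤-refl

      -- Eligibility is exactly this bound after one more use, and targets never decrease.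
      used≤target : ∀ n c → ι (used (state n) c) ℚ.≤ target c n
      used≤target n c = invariant (λ n s → ι (used s c) ℚ.≤ target c n) (ℚ.≤-reflexive ι-zero) pres n
        where
        pres : ∀ n {s t} → Step n s t → ι (used s c) ℚ.≤ target c n → ι (used t c) ℚ.≤ target c (suc n)
        pres n emit u≤ = ℚ.≤-trans u≤ (Q-suc-≤ _ n)
        pres n (idle _) u≤ = ℚ.≤-trans u≤ (Q-suc-≤ _ n)
        pres n (insert {u} c′ _ elig _) u≤ with c′ ℕ.≟ c
        ... | yes refl = ℚ.≤-trans elig (Q-suc-≤ _ n)
        ... | no _     = ℚ.≤-trans u≤ (Q-suc-≤ _ n)

      -- Windows of digits versus pending blocks

      pending-tail : ∀ {n s t d r} → Step n s t → pending s ≡ d ∷ r → pending t ≡ r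
      pending-tail emit refl = refl
      pending-tail (insert _ _ _ _) ()
      pending-tail (idle _) ()

      digits-∷ : ∀ n {d r} → pending (state n) ≡ d ∷ r → digits n ≡ d
      digits-∷ n e = cong (emitted (half n)) e

      pending⇒window : ∀ n {k} (B : Vec ℕ k) →
        take k (pending (state n)) ≡ Vec.toList B → window digits n k ≡ B
      pending⇒window n [] _ = refl
      pending⇒window n {suc k} (b ∷ B) e with pending (state n) in eq
      pending⇒window n {suc k} (b ∷ B) () | []
      ... | d ∷ r = trans (window-suc digits n k) (cong₂ _∷_
            (trans (digits-∷ n eq) (∷-injectiveˡ e))
            (pending⇒window (suc n) B (trans (cong (take k) (pending-tail (state-step n) eq)) (∷-injectiveʳ e))))

      -- When the digits of `B` are below every default digit from `n` on, no default digit can take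
      -- part in an occurrence, so the pending list must supply all of it.
      window⇒pending : ∀ n {k} (B : Vec ℕ k) →
        All (λ b → ∀ j → n ℕ.≤ j → b ℕ.< half j) (Vec.toList B) →
        window digits n k ≡ B → take k (pending (state n)) ≡ Vec.toList B
      window⇒pending n [] _ _ = refl
      window⇒pending n {suc k} (b ∷ B) (b< ∷ B<) e
        with pending (state n) in eq | trans (sym (window-suc digits n k)) e
      ... | []    | e′ = ⊥-elim (ℕ.<-irrefl (sym (Vec.∷-injectiveˡ e′)) (b< n ℕ.≤-refl))
      ... | d ∷ r | e′ = cong₂ _∷_ (Vec.∷-injectiveˡ e′)
            (trans (cong (take k) (sym (pending-tail (state-step n) eq)))
              (window⇒pending (suc n) B (All.map (λ lt j n<j → lt j (ℕ.<⇒≤ n<j)) B<) (Vec.∷-injectiveʳ e′)))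

      half-eventually : ∀ m → Eventually (λ j → m ℕ.≤ half j)
      half-eventually m = eventually-map
        (λ j lt → ℕ.≤-trans (ℕ.≤-reflexive (ℕ.n≡⌊n+n/2⌋ m)) (ℕ.⌊n/2⌋-mono (ℕ.∸-monoˡ-≤ 1 lt)))
        (q-eventually (suc (m ℕ.+ m)))

      below-half : ∀ l → ∃[ m ] All (λ b → ∀ j → m ℕ.≤ j → b ℕ.< half j) l
      below-half l = let (m , lt) = half-eventually (suc (sum (map suc l))) in
        m , All.map (λ b≤ j m≤j → ℕ.≤-trans (s≤s b≤) (lt j m≤j)) (digits≤weight l)

      used-step : ∀ {n s t} c → Step n s t →
        used t c ≡ used s c ⊎ (used t c ≡ suc (used s c) × pending t ≡ block c)
      used-step c emit = inj₁ refl
      used-step c (idle _) = inj₁ refl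
      used-step c (insert {u} d _ _ _) with d ℕ.≟ c
      ... | yes refl = inj₂ (refl , refl)
      ... | no d≢c   = inj₁ refl

      -- Occurrences of a fixed block

      module _ {k : ℕ} (b₀ : ℕ) (B₀ : Vec ℕ k) where

        B : Vec ℕ (suc k)
        B = b₀ ∷ B₀

        β : List ℕ
        β = Vec.toList B

        β-length : length β ≡ suc k
        β-length = Vec.length-toList B

        b : ℕ
        b = index b₀ (Vec.toList B₀)

        block-b : block b ≡ β
        block-b = block-index b₀ (Vec.toList B₀)

        Occurs? : (i : ℕ) → Dec (window digits i (suc k) ≡ B)
        Occurs? i = Vec.≡-dec ℕ._≟_ (window digits i (suc k)) B

        used≤occurrences : ∀ n → used (state n) b ℕ.≤ count Occurs? (suc n)
        used≤occurrences zero = z≤n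
        used≤occurrences (suc n) with used-step b (state-step n)
        ... | inj₁ same = ℕ.≤-trans (ℕ.≤-trans (ℕ.≤-reflexive same) (used≤occurrences n))
              (ℕ.≤-trans (ℕ.m≤m+n _ _) (ℕ.≤-reflexive (sym (count-suc Occurs? (suc n)))))
        -- A block chosen at step `n` occurs at position `n + 1`, hence the shifted count.
        ... | inj₂ (more , fresh) = ℕ.≤-trans (ℕ.≤-reflexive more) (ℕ.≤-trans (s≤s (used≤occurrences n))
              (ℕ.≤-reflexive (sym (count-suc-yes Occurs? (suc n) (pending⇒window (suc n) B
                (trans (cong (take (suc k)) (trans fresh block-b))
                  (take-all (suc k) β (ℕ.≤-reflexive β-length))))))))

        -- An overestimate of the occurrences inside longer blocks: each use of such a block is
        -- charged its whole length.
        longUse : ℕ → (ℕ → ℕ) → ℕ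
        longUse m u = ∑ℕ (λ c → longLength β c ℕ.* u c) m

        longUse-mono : ∀ c u → ∀ d → longLength β d ℕ.* u d ℕ.≤ longLength β d ℕ.* bump c u d
        longUse-mono c u d = ℕ.*-monoʳ-≤ (longLength β d) (≤bump c u d)

        -- A longer block has at most as many hits as digits, and `longUse` pays for them. A block
        -- that is not longer has no hit unless it is B; then it has one, paid for by the new use of
        -- `b`.
        hits-insert : ∀ m c u → c ℕ.< m →
          hits β (block c) ℕ.+ (u b ℕ.+ longUse m u) ℕ.≤ bump c u b ℕ.+ longUse m (bump c u)
        hits-insert m c u c<m with length β ℕ.<? length (block c) in eq
        ... | yes long = begin
          h ℕ.+ (u b ℕ.+ longUse m u)    ≡⟨ ℕ.+-assoc h (u b) _ ⟨
          h ℕ.+ u b ℕ.+ longUse m u      ≡⟨ cong (ℕ._+ longUse m u) (ℕ.+-comm h (u b)) ⟩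
          u b ℕ.+ h ℕ.+ longUse m u      ≡⟨ ℕ.+-assoc (u b) h _ ⟩
          u b ℕ.+ (h ℕ.+ longUse m u)    ≤⟨ ℕ.+-mono-≤ (≤bump c u b)
              (∑ℕ-mono-rise _ _ m c h c<m (longUse-mono c u) rise) ⟩
          bump c u b ℕ.+ longUse m (bump c u) ∎
          where
          open ℕ.≤-Reasoning
          h = hits β (block c)
          rise : h ℕ.+ longLength β c ℕ.* u c ℕ.≤ longLength β c ℕ.* bump c u c
          rise rewrite eq | bump-≡ c u | ℕ.*-suc (length (block c)) (u c) =
            ℕ.+-monoˡ-≤ (length (block c) ℕ.* u c) (hits≤length β (block c))
        ... | no short with ≡-dec ℕ._≟_ (block c) β
        ...   | no ≢β rewrite hits-zero β (block c) (ℕ.≮⇒≥ short) ≢β =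
                ℕ.+-mono-≤ (≤bump c u b) (∑ℕ-mono _ _ m (longUse-mono c u))
        ...   | yes ≡β = subst (λ z → hits β (block c) ℕ.+ (u b ℕ.+ longUse m u) ℕ.≤ z ℕ.+ longUse m (bump c u))
                  (sym (trans (cong (λ z → bump z u b) c≡b) (bump-≡ b u)))
                  (ℕ.+-mono-≤ (hits≤1 β (block c) (ℕ.≮⇒≥ short))
                    (ℕ.+-monoʳ-≤ (u b) (∑ℕ-mono _ _ m (longUse-mono c u))))
          where
          c≡b : c ≡ b
          c≡b = index-block c ≡β

        onset : ℕ
        onset = proj₁ (below-half β)

        -- Pays for all positions before `onset` and for the block that is being written at that
        -- moment.
        surplus : ℕ
        surplus = onset ℕ.+ length (pending (state onset))

        []≢β : take (length β) [] ≢ β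
        []≢β ()

        -- The occurrences that the pending block is going to produce are counted in advance.
        occurrences-step : ∀ {n s t} m → stage n ℕ.≤ m → Step n s t →
          (window digits n (suc k) ≡ B → take (length β) (pending s) ≡ β) →
          count Occurs? n ℕ.+ hits β (pending s) ℕ.≤ surplus ℕ.+ (used s b ℕ.+ longUse m (used s)) →
          count Occurs? (suc n) ℕ.+ hits β (pending t) ℕ.≤ surplus ℕ.+ (used t b ℕ.+ longUse m (used t))
        occurrences-step {n} m a≤m (emit {d} {r}) found le with Occurs? n
        ... | yes occ rewrite count-suc-yes Occurs? n occ = ℕ.≤-trans (ℕ.≤-reflexive
              (trans (sym (ℕ.+-suc _ _)) (cong (count Occurs? n ℕ.+_) (sym (hits-accept β d r (found occ)))))) le
        ... | no ¬occ rewrite count-suc-no Occurs? n ¬occ =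
              ℕ.≤-trans (ℕ.+-monoʳ-≤ (count Occurs? n) (hits≤hits-∷ β d r)) le
        occurrences-step {n} m a≤m (idle _) found le
          rewrite count-suc-no Occurs? n (λ occ → []≢β (found occ)) = le
        occurrences-step {n} m a≤m (insert {u} c c<a _ _) found le
          rewrite count-suc-no Occurs? n (λ occ → []≢β (found occ)) = begin
          count Occurs? n ℕ.+ h
            ≤⟨ ℕ.+-monoˡ-≤ h (subst (ℕ._≤ surplus ℕ.+ (u b ℕ.+ longUse m u)) (ℕ.+-identityʳ _) le) ⟩
          surplus ℕ.+ (u b ℕ.+ longUse m u) ℕ.+ h               ≡⟨ ℕ.+-assoc surplus _ h ⟩
          surplus ℕ.+ (u b ℕ.+ longUse m u ℕ.+ h)
            ≡⟨ cong (surplus ℕ.+_) (ℕ.+-comm _ h) ⟩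
          surplus ℕ.+ (h ℕ.+ (u b ℕ.+ longUse m u))
            ≤⟨ ℕ.+-monoʳ-≤ surplus (hits-insert m c u (ℕ.≤-trans c<a a≤m)) ⟩
          surplus ℕ.+ (bump c u b ℕ.+ longUse m (bump c u))     ∎
          where
          open ℕ.≤-Reasoning
          h = hits β (block c)

        occurrences≤ : ∀ n → onset ℕ.≤ n →
          count Occurs? n ℕ.≤ surplus ℕ.+ (used (state n) b ℕ.+ longUse (stage n) (used (state n)))
        -- The range of `longUse` is frozen at the final `stage N`, so the induction over `n`
        -- compares sums over the same blocks.
        occurrences≤ N onset≤N = ℕ.≤-trans (ℕ.m≤m+n _ _) (≤-induction onset
          (λ n → n ℕ.≤ N → count Occurs? n ℕ.+ hits β (pending (state n)) ℕ.≤
            surplus ℕ.+ (used (state n) b ℕ.+ longUse (stage N) (used (state n))))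
          (λ _ → ℕ.≤-trans
            (ℕ.+-mono-≤ (count≤ Occurs? onset) (hits≤length β (pending (state onset))))
            (ℕ.m≤m+n surplus _))
          (λ n onset≤n ih n<N → occurrences-step (stage N) (stage-mono (ℕ.<⇒≤ n<N)) (state-step n)
            (λ occ → trans (cong (λ l → take l (pending (state n))) β-length)
              (window⇒pending n B (All.map (λ lt j n≤j → lt j (ℕ.≤-trans onset≤n n≤j)) (proj₂ (below-half β))) occ))
            (ih (ℕ.<⇒≤ n<N)))
          N onset≤N ℕ.≤-refl)

      -- Bounded debt of the blocks with index at most b

      recip≤1 : ∀ i k → recip i k ℚ.≤ 1ℚ
      recip≤1 i k = subst (recip i k ℚ.≤_) (recip-zero i) (recip-anti i z≤n)

      module _ (b : ℕ) where

        deficit : ℕ → (ℕ → ℕ) → ℕ → ℚ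
        deficit n u c = target c n ℚ.- ι (u c)

        debt : ℕ → (ℕ → ℕ) → ℚ
        debt n u = ∑ (deficit n u) (suc b)

        -- ρ bounds the growth of every target from now on, so that a pending block of length l
        -- lets the debt grow by at most l (b + 1) ρ until the next choice.
        Bounded : ℚ → ℕ → State → Set
        Bounded C n s = ∃[ ρ ] (0ℚ ℚ.≤ ρ × (∀ j k → n ℕ.≤ j → recip j (suc k) ℚ.≤ ρ) ×
          debt n (used s) ℚ.+ ι (length (pending s) ℕ.* suc b) ℚ.* ρ ℚ.≤ C)

        bounded⇒debt≤ : ∀ {C n s} → Bounded C n s → debt n (used s) ℚ.≤ C
        bounded⇒debt≤ {C} {n} {s} (ρ , 0≤ρ , _ , le) = ℚ.≤-trans
          (difference-≤ (0≤* (0≤ι (length (pending s) ℕ.* suc b)) 0≤ρ)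
            (solve 2 (λ d x → d :+ x :- d := x :- con 0ℚ) refl
              (debt n (used s)) (ι (length (pending s) ℕ.* suc b) ℚ.* ρ))) le

        deficit-suc : ∀ {ρ} n u c → (∀ k → recip n (suc k) ℚ.≤ ρ) → deficit (suc n) u c ℚ.≤ deficit n u c ℚ.+ ρ
        -- Blocks are non-empty by construction, so their length is a successor by computation.
        deficit-suc {ρ} n u c r≤ρ = difference-≤ (r≤ρ (ℕ.pred (length (block c))))
          (solve 4 (λ t r x ρ → (t :- x :+ ρ) :- (t :+ r :- x) := ρ :- r) refl
            (target c n) (recip n (length (block c))) (ι (u c)) ρ)

        deficit-bump : ∀ n c u d → deficit n (bump c u) d ℚ.≤ deficit n u d
        deficit-bump n c u d = ℚ.+-monoʳ-≤ (target d n) (ℚ.neg-antimono-≤ (ι-mono (≤bump c u d)))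

        deficit-bumped : ∀ n c u → deficit n (bump c u) c ≡ deficit n u c ℚ.- 1ℚ
        deficit-bumped n c u = trans (cong (λ z → target c n ℚ.- z) (trans (cong ι (bump-≡ c u)) (ι-suc (u c))))
          (solve 2 (λ t x → t :- (con 1ℚ :+ x) := t :- x :- con 1ℚ) refl (target c n) (ι (u c)))

        deficit-ineligible : ∀ n u c → ¬ Eligible n u c → deficit n u c ℚ.≤ 1ℚ
        deficit-ineligible n u c ¬e = difference-≤ (ℚ.<⇒≤ (ℚ.≰⇒> ¬e))
          (trans (solve 2 (λ t x → con 1ℚ :- (t :- x) := (con 1ℚ :+ x) :- t) refl (target c n) (ι (u c)))
            (cong (ℚ._- target c n) (sym (ι-suc (u c)))))

        rate : ℕ → ℕ
        rate n = stage n ℕ.* suc (totalWeight (stage n))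

        recip≤rate : ∀ n j k → n ℕ.≤ j → recip j (suc k) ℚ.≤ inv (rate n)
        recip≤rate n j k n≤j = recip≤inv j k (rate n) (ℕ.≤-trans
          (s≤s (ℕ.*-mono-≤ (stage-mono n≤j) (s≤s (∑ℕ-mono-≤ weight (stage-mono n≤j)))))
          (sparse (stage-good j)))

        -- The factor `suc l` covers the `l` digits of the block and the position at which it is
        -- chosen; `sparse` was made for this product.
        budget : ∀ n l → suc b ℕ.≤ stage n → l ℕ.≤ totalWeight (stage n) →
          ι (suc l ℕ.* suc b) ℚ.* inv (rate n) ℚ.≤ 1ℚ
        budget n l b<a l≤w = begin
          ι (suc l ℕ.* suc b) ℚ.* inv (rate n)   ≤⟨ *-monoʳ-≤ (0≤inv (rate n)) (ι-mono small) ⟩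
          ι (suc (rate n)) ℚ.* inv (rate n)      ≡⟨ ℚ.*-comm (ι (suc (rate n))) (inv (rate n)) ⟩
          inv (rate n) ℚ.* ι (suc (rate n))      ≡⟨ inv-ι (rate n) ⟩
          1ℚ ∎
          where
          open ℚ.≤-Reasoning
          small : suc l ℕ.* suc b ℕ.≤ suc (rate n)
          small = ℕ.≤-trans (ℕ.≤-reflexive (ℕ.*-comm (suc l) (suc b)))
            (ℕ.≤-trans (ℕ.*-mono-≤ b<a (s≤s l≤w)) (ℕ.n≤1+n (rate n)))

        split : ∀ l ρ → ι (suc l ℕ.* suc b) ℚ.* ρ ≡ ι (suc b) ℚ.* ρ ℚ.+ ι (l ℕ.* suc b) ℚ.* ρ
        split l ρ = trans (cong (ℚ._* ρ) (ι-+ (suc b) (l ℕ.* suc b))) (ℚ.*-distribʳ-+ ρ (ι (suc b)) (ι (l ℕ.* suc b)))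

        -- Writing one digit raises the debt by at most `(b + 1) ρ`, exactly what the shortened
        -- pending list releases.
        bounded-emit : ∀ {C n d r u} → Bounded C n (d ∷ r , u) → Bounded C (suc n) (r , u)
        bounded-emit {C} {n} {d} {r} {u} (ρ , 0≤ρ , r≤ρ , le) =
          ρ , 0≤ρ , (λ j k n<j → r≤ρ j k (ℕ.<⇒≤ n<j)) , (begin
          debt (suc n) u ℚ.+ x
            ≤⟨ ℚ.+-monoˡ-≤ x (∑-mono-+ (deficit (suc n) u) (deficit n u) ρ (suc b)
                 λ c _ → deficit-suc n u c λ k → r≤ρ n k ℕ.≤-refl) ⟩
          (debt n u ℚ.+ ι (suc b) ℚ.* ρ) ℚ.+ x   ≡⟨ ℚ.+-assoc (debt n u) _ x ⟩
          debt n u ℚ.+ (ι (suc b) ℚ.* ρ ℚ.+ x)   ≡⟨ cong (debt n u ℚ.+_) (split (length r) ρ) ⟨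
          debt n u ℚ.+ ι (suc (length r) ℕ.* suc b) ℚ.* ρ ≤⟨ le ⟩
          C ∎)
          where
          open ℚ.≤-Reasoning
          x = ι (length r ℕ.* suc b) ℚ.* ρ

        -- At each choice the old `ρ` is replaced by the current rate. `D` stands for the debt after
        -- the choice but before the targets grow; the extra 1 is the budget until the next choice.
        bounded-fresh : ∀ {C} n l u → suc b ℕ.≤ stage n → length l ℕ.≤ totalWeight (stage n) → ∀ D →
          debt (suc n) u ℚ.≤ D ℚ.+ ι (suc b) ℚ.* inv (rate n) → D ℚ.+ 1ℚ ℚ.≤ C → Bounded C (suc n) (l , u)
        bounded-fresh {C} n l u b<a l≤w D debt≤ D+1≤C =
          ρ , 0≤inv (rate n) , (λ j k n<j → recip≤rate n j k (ℕ.<⇒≤ n<j)) , (begin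
          debt (suc n) u ℚ.+ x                        ≤⟨ ℚ.+-monoˡ-≤ x debt≤ ⟩
          (D ℚ.+ ι (suc b) ℚ.* ρ) ℚ.+ x               ≡⟨ ℚ.+-assoc D _ x ⟩
          D ℚ.+ (ι (suc b) ℚ.* ρ ℚ.+ x)               ≡⟨ cong (D ℚ.+_) (split (length l) ρ) ⟨
          D ℚ.+ ι (suc (length l) ℕ.* suc b) ℚ.* ρ
            ≤⟨ ℚ.+-monoʳ-≤ D (budget n (length l) b<a l≤w) ⟩
          D ℚ.+ 1ℚ                                    ≤⟨ D+1≤C ⟩
          C ∎)
          where
          open ℚ.≤-Reasoning
          ρ = inv (rate n)
          x = ι (length l ℕ.* suc b) ℚ.* ρ

        debt-suc : ∀ n u → debt (suc n) u ℚ.≤ debt n u ℚ.+ ι (suc b) ℚ.* inv (rate n)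
        debt-suc n u = ∑-mono-+ (deficit (suc n) u) (deficit n u) (inv (rate n)) (suc b)
          λ c _ → deficit-suc n u c λ k → recip≤rate n n k ℕ.≤-refl

        debt-bump : ∀ n c u → debt n (bump c u) ℚ.≤ debt n u
        debt-bump n c u = ∑-mono (deficit n (bump c u)) (deficit n u) (suc b) λ d _ → deficit-bump n c u d

        debt-ineligible : ∀ n u → (∀ d → d ℕ.< suc b → ¬ Eligible n u d) → debt n u ℚ.≤ ι (suc b)
        debt-ineligible n u none = ∑-≤1 (deficit n u) (suc b) λ d d≤b → deficit-ineligible n u d (none d d≤b)

        bounded-step : ∀ {C n s t} → ι (suc b) ℚ.+ 1ℚ ℚ.≤ C → suc b ℕ.≤ stage n →
          Step n s t → Bounded C n s → Bounded C (suc n) t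
        bounded-step C≥ b<a (emit {d} {r} {u}) bd = bounded-emit {d = d} {r} {u} bd
        bounded-step {C} {n} C≥ b<a (idle {u} none) bd = bounded-fresh n [] u b<a z≤n (ι (suc b))
          (ℚ.≤-trans (debt-suc n u) (ℚ.+-monoˡ-≤ _ (debt-ineligible n u λ d d≤b → none d (ℕ.≤-trans d≤b b<a)))) C≥
        bounded-step {C} {n} C≥ b<a (insert {u} c c<a elig least) bd with c ℕ.<? suc b
        -- Since `c` is the least eligible index, no block up to `b` is eligible: the debt is at
        -- most `b + 1`, whatever it was bounded by before.
        ... | no c≮ = bounded-fresh n (block c) (bump c u) b<a
              (ℕ.≤-trans (length≤weight (block c)) (weight≤stage c<a ℕ.≤-refl)) (ι (suc b))
              (ℚ.≤-trans (debt-suc n (bump c u)) (ℚ.+-monoˡ-≤ _ (ℚ.≤-trans (debt-bump n c u)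
                (debt-ineligible n u λ d d≤b → least d (ℕ.≤-trans d≤b (ℕ.≮⇒≥ c≮)))))) C≥
        -- The debt loses 1 here, which pays for its growth until the next choice, so the old bound
        -- `C` survives.
        ... | yes c≤b = bounded-fresh n (block c) (bump c u) b<a
              (ℕ.≤-trans (length≤weight (block c)) (weight≤stage c<a ℕ.≤-refl)) (debt n u ℚ.- 1ℚ)
              (ℚ.≤-trans (∑-mono-drop (deficit (suc n) (bump c u)) (deficit n u) ρ (suc b) c c≤b
                  (λ d _ → ℚ.≤-trans (deficit-suc n (bump c u) d r≤ρ) (ℚ.+-monoˡ-≤ ρ (deficit-bump n c u d)))
                  (ℚ.≤-trans (deficit-suc n (bump c u) c r≤ρ) (ℚ.≤-reflexive
                    (trans (cong (ℚ._+ ρ) (deficit-bumped n c u))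
                      (solve 2 (λ x ρ → x :- con 1ℚ :+ ρ := x :+ ρ :- con 1ℚ) refl (deficit n u c) ρ)))))
                (ℚ.≤-reflexive (solve 2 (λ x y → x :+ y :- con 1ℚ := x :- con 1ℚ :+ y) refl
                  (debt n u) (ι (suc b) ℚ.* ρ))))
              (ℚ.≤-trans (ℚ.≤-reflexive (solve 1 (λ x → x :- con 1ℚ :+ con 1ℚ := x) refl (debt n u)))
                (bounded⇒debt≤ {s = [] , u} bd))
          where
          ρ = inv (rate n)
          r≤ρ : ∀ k → recip n (suc k) ℚ.≤ ρ
          r≤ρ k = recip≤rate n n k ℕ.≤-refl

        deficit-bounded : ∃[ C ] (Eventually λ n → target b n ℚ.≤ ι (used (state n) b) ℚ.+ C)
        deficit-bounded = C , T , λ n T≤n → difference-≤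
          (ℚ.≤-trans (∑-term (deficit n (used (state n))) (suc b) b (ℕ.n<1+n b) (λ c _ → 0≤deficit n c))
            (bounded⇒debt≤ {s = state n} (bounded n T≤n)))
          (solve 3 (λ t x c → (x :+ c) :- t := c :- (t :- x)) refl (target b n) (ι (used (state n) b)) C)
          where
          T = proj₁ (stage-unbounded (suc b))
          s = state T
          x = debt T (used s) ℚ.+ ι (length (pending s) ℕ.* suc b) ℚ.* 1ℚ
          y = ι (suc b) ℚ.+ 1ℚ
          -- `x` covers the debt and the unfinished block at time `T`, with the crude rate 1; `y`
          -- covers every later moment without an eligible block up to `b`.
          C = x ℚ.⊔ y
          bounded : ∀ n → T ℕ.≤ n → Bounded C n (state n)
          bounded = ≤-induction T (λ n → Bounded C n (state n))
            (1ℚ , 0≤1 , (λ j k _ → recip≤1 j (suc k)) , ℚ.p≤p⊔q x y)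
            λ n T≤n bd → bounded-step (ℚ.p≤q⊔p x y) (proj₂ (stage-unbounded (suc b)) n T≤n) (state-step n) bd
          0≤deficit : ∀ n c → 0ℚ ℚ.≤ deficit n (used (state n)) c
          0≤deficit n c = difference-≤ (used≤target n c)
            (solve 2 (λ t x → t :- x :- con 0ℚ := t :- x) refl (target c n) (ι (used (state n) c)))

      -- Asymptotic frequencies

      archimedean : ∀ p → ∃[ m ] p ℚ.≤ ι m
      -- An index `n` with Q_n^(1) > p will do, because Q_n^(1) ≤ n.
      archimedean p = let (n , lt) = Q→∞ 0 p in
        n , ℚ.≤-trans (ℚ.<⇒≤ (lt n ℕ.≤-refl)) (∑-≤1 (λ i → recip i 1) n λ i _ → recip≤1 i 1)

      module _ (η : ℚ) (0<η : 0ℚ ℚ.< η) where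

        private
          instance
            η-pos : ℚ.Positive η
            η-pos = ℚ.positive 0<η
            η-nonZero : ℚ.NonZero η
            η-nonZero = ℚ.pos⇒nonZero η
          0≤η = ℚ.<⇒≤ 0<η

        constant-negligible : ∀ k C → Eventually (λ n → C ℚ.≤ η ℚ.* Q⟨ suc k ⟩ n)
        constant-negligible k C = eventually-map (λ n lt → scaled-bound η C (ℚ.<⇒≤ lt)) (Q→∞ k (C ℚ.* ℚ.1/ η))

        module _ {k : ℕ} (b₀ : ℕ) (B₀ : Vec ℕ k) where

          private
            occ : ℕ → ℕ
            occ = count (Occurs? b₀ B₀)

            target≡ : ∀ n → target (b b₀ B₀) n ≡ Q⟨ suc k ⟩ n
            target≡ n = cong (λ l → Q⟨ l ⟩ n) (trans (cong length (block-b b₀ B₀)) (β-length b₀ B₀))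

          -- With a the stage and w its total weight, the sum is at most w Q_n^(k+2). `rare` bounds
          -- a times this by Q_n^(k+1), and a ≥ 1/η eventually.
          longUse-negligible :
            Eventually (λ n → ι (longUse b₀ B₀ (stage n) (used (state n))) ℚ.≤ η ℚ.* Q⟨ suc k ⟩ n)
          longUse-negligible = eventually-map bound (stage-unbounded (m ℕ.+ suc k))
            where
            open ℚ.≤-Reasoning
            arch = archimedean (1ℚ ℚ.* ℚ.1/ η)
            m = proj₁ arch
            bound : ∀ n → m ℕ.+ suc k ℕ.≤ stage n →
              ι (longUse b₀ B₀ (stage n) (used (state n))) ℚ.≤ η ℚ.* Q⟨ suc k ⟩ n
            bound n m+k≤a = begin
              x                         ≡⟨ ℚ.*-identityˡ x ⟨
              1ℚ ℚ.* x
                ≤⟨ *-monoʳ-≤ (0≤ι _) (scaled-bound η 1ℚ (ℚ.≤-trans (proj₂ arch) (ι-mono (ℕ.m+n≤o⇒m≤o m m+k≤a)))) ⟩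
              (η ℚ.* ι a) ℚ.* x
                ≤⟨ *-monoˡ-≤ (0≤* 0≤η (0≤ι a)) (∑ℕ-scaled _ weight _ a λ c _ → term c) ⟩
              (η ℚ.* ι a) ℚ.* (ι w ℚ.* Q⟨ suc (suc k) ⟩ n)
                ≡⟨ solve 4 (λ e a w q → (e :* a) :* (w :* q) := e :* ((a :* w) :* q)) refl
                     η (ι a) (ι w) (Q⟨ suc (suc k) ⟩ n) ⟩
              η ℚ.* ((ι a ℚ.* ι w) ℚ.* Q⟨ suc (suc k) ⟩ n)
                ≡⟨ cong (λ z → η ℚ.* (z ℚ.* Q⟨ suc (suc k) ⟩ n)) (ι-* a w) ⟨
              η ℚ.* (ι (a ℕ.* w) ℚ.* Q⟨ suc (suc k) ⟩ n)
                ≤⟨ *-monoˡ-≤ 0≤η (rare (stage-good n) k (ℕ.m+n≤o⇒n≤o m m+k≤a)) ⟩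
              η ℚ.* Q⟨ suc k ⟩ n ∎
              where
              a = stage n
              w = totalWeight a
              x = ι (longUse b₀ B₀ a (used (state n)))
              term : ∀ c → ι (longLength (β b₀ B₀) c ℕ.* used (state n) c) ℚ.≤ ι (weight c) ℚ.* Q⟨ suc (suc k) ⟩ n
              term c with length (β b₀ B₀) ℕ.<? length (block c)
              ... | no _ = subst (ℚ._≤ ι (weight c) ℚ.* Q⟨ suc (suc k) ⟩ n) (sym ι-zero)
                             (0≤* (0≤ι (weight c)) (0≤Q (suc (suc k)) n))
              ... | yes long = begin
                ι (length (block c) ℕ.* used (state n) c)
                  ≡⟨ ι-* (length (block c)) (used (state n) c) ⟩
                ι (length (block c)) ℚ.* ι (used (state n) c)
                  ≤⟨ *-monoˡ-≤ (0≤ι (length (block c))) (used≤target n c) ⟩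
                ι (length (block c)) ℚ.* target c n
                  ≤⟨ *-monoʳ-≤ (0≤Q (length (block c)) n) (ι-mono (length≤weight (block c))) ⟩
                ι (weight c) ℚ.* target c n
                  ≤⟨ *-monoˡ-≤ (0≤ι (weight c)) (Q-anti n (subst (ℕ._< length (block c)) (β-length b₀ B₀) long)) ⟩
                ι (weight c) ℚ.* Q⟨ suc (suc k) ⟩ n ∎

          occurrences-upper : Eventually (λ n → ι (occ n) ℚ.≤ Q⟨ suc k ⟩ n ℚ.+ (η ℚ.+ η) ℚ.* Q⟨ suc k ⟩ n)
          occurrences-upper = eventually-map bound (eventually-× (onset b₀ B₀ , λ n le → le)
            (eventually-× (constant-negligible k (ι S)) longUse-negligible))
            where
            open ℚ.≤-Reasoning
            S = surplus b₀ B₀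
            bound : ∀ n → onset b₀ B₀ ℕ.≤ n × ι S ℚ.≤ η ℚ.* Q⟨ suc k ⟩ n ×
              ι (longUse b₀ B₀ (stage n) (used (state n))) ℚ.≤ η ℚ.* Q⟨ suc k ⟩ n →
              ι (occ n) ℚ.≤ Q⟨ suc k ⟩ n ℚ.+ (η ℚ.+ η) ℚ.* Q⟨ suc k ⟩ n
            bound n (onset≤n , S≤ , L≤) = begin
              ι (occ n)                          ≤⟨ ι-mono (occurrences≤ b₀ B₀ n onset≤n) ⟩
              ι (S ℕ.+ (u ℕ.+ L))                ≡⟨ ι-+ S (u ℕ.+ L) ⟩
              ι S ℚ.+ ι (u ℕ.+ L)                ≡⟨ cong (ι S ℚ.+_) (ι-+ u L) ⟩
              ι S ℚ.+ (ι u ℚ.+ ι L)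
                ≤⟨ ℚ.+-mono-≤ S≤ (ℚ.+-mono-≤ (ℚ.≤-trans (used≤target n (b b₀ B₀)) (ℚ.≤-reflexive (target≡ n))) L≤) ⟩
              η ℚ.* q′ ℚ.+ (q′ ℚ.+ η ℚ.* q′)
                ≡⟨ solve 2 (λ e q → e :* q :+ (q :+ e :* q) := q :+ (e :+ e) :* q) refl η q′ ⟩
              q′ ℚ.+ (η ℚ.+ η) ℚ.* q′ ∎
              where
              u = used (state n) (b b₀ B₀)
              L = longUse b₀ B₀ (stage n) (used (state n))
              q′ = Q⟨ suc k ⟩ n

          occurrences-lower : Eventually (λ n →
            Q⟨ suc k ⟩ (suc n) ℚ.≤ ι (occ (suc n)) ℚ.+ (η ℚ.+ η) ℚ.* Q⟨ suc k ⟩ (suc n))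
          occurrences-lower = eventually-map bound (eventually-× (proj₂ lower) (constant-negligible k (C ℚ.+ 1ℚ)))
            where
            open ℚ.≤-Reasoning
            lower = deficit-bounded (b b₀ B₀)
            C = proj₁ lower
            bound : ∀ n →
              target (b b₀ B₀) n ℚ.≤ ι (used (state n) (b b₀ B₀)) ℚ.+ C ×
              C ℚ.+ 1ℚ ℚ.≤ η ℚ.* Q⟨ suc k ⟩ n →
              Q⟨ suc k ⟩ (suc n) ℚ.≤ ι (occ (suc n)) ℚ.+ (η ℚ.+ η) ℚ.* Q⟨ suc k ⟩ (suc n)
            bound n (t≤ , C≤) = begin
              -- Uses up to state `n` are counted up to `n + 1`; the extra term of the target is at
              -- most 1, hence `C + 1`.
              Q⟨ suc k ⟩ n ℚ.+ recip n (suc k)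
                ≤⟨ ℚ.+-mono-≤ (ℚ.≤-trans (ℚ.≤-reflexive (sym (target≡ n))) t≤) (recip≤1 n (suc k)) ⟩
              (ι u ℚ.+ C) ℚ.+ 1ℚ                ≡⟨ ℚ.+-assoc (ι u) C 1ℚ ⟩
              ι u ℚ.+ (C ℚ.+ 1ℚ)
                ≤⟨ ℚ.+-mono-≤ (ι-mono (used≤occurrences b₀ B₀ n)) C≤ ⟩
              ι (occ (suc n)) ℚ.+ η ℚ.* Q⟨ suc k ⟩ n
                ≤⟨ ℚ.+-monoʳ-≤ (ι (occ (suc n))) (*-monoˡ-≤ 0≤η (Q-suc-≤ (suc k) n)) ⟩
              ι (occ (suc n)) ℚ.+ η ℚ.* q′
                ≤⟨ ℚ.+-monoʳ-≤ (ι (occ (suc n))) (difference-≤ (0≤* 0≤η (0≤Q (suc k) (suc n)))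
                    (solve 2 (λ e q → (e :+ e) :* q :- e :* q := e :* q :- con 0ℚ) refl η q′)) ⟩
              ι (occ (suc n)) ℚ.+ (η ℚ.+ η) ℚ.* q′ ∎
              where
              u = used (state n) (b b₀ B₀)
              q′ = Q⟨ suc k ⟩ (suc n)

      normal : ∀ η → 0ℚ ℚ.< η → ∀ {k} (B : Vec ℕ (suc k)) → Eventually λ n →
        ι (occurrences B digits (suc n)) ℚ.≤ Q⟨ suc k ⟩ (suc n) ℚ.+ (η ℚ.+ η) ℚ.* Q⟨ suc k ⟩ (suc n) ×
        Q⟨ suc k ⟩ (suc n) ℚ.≤ ι (occurrences B digits (suc n)) ℚ.+ (η ℚ.+ η) ℚ.* Q⟨ suc k ⟩ (suc n)
      normal η 0<η (b₀ ∷ B₀) = eventually-×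
        (proj₁ upper , λ n le → proj₂ upper (suc n) (ℕ.m≤n⇒m≤1+n le))
        (occurrences-lower η 0<η b₀ B₀)
        where upper = occurrences-upper η 0<η b₀ B₀

    open Stage Good good-zero good-eventually using (stage; stage-good; stage-mono; stage-unbounded)

    normal-digits : ∃[ E ] ((∀ n → E n ℕ.≤ ⌊ q n ℕ.∸ 1 /2⌋) ×
      (∀ η → 0ℚ ℚ.< η → ∀ {k} (B : Vec ℕ (suc k)) → Eventually λ n →
        ι (occurrences B E (suc n)) ℚ.≤ Q⟨ suc k ⟩ (suc n) ℚ.+ (η ℚ.+ η) ℚ.* Q⟨ suc k ⟩ (suc n) ×
        Q⟨ suc k ⟩ (suc n) ℚ.≤ ι (occurrences B E (suc n)) ℚ.+ (η ℚ.+ η) ℚ.* Q⟨ suc k ⟩ (suc n)))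
    normal-digits = digits , digits≤half , normal
      where open Schedule stage stage-good stage-mono stage-unbounded

  -- Partial sums and integer parts of the orbit

  module PartialSums (E : ℕ → ℕ) (E≤half : ∀ n → E n ℕ.≤ ⌊ q n ℕ.∸ 1 /2⌋) where

    open ℚ.≤-Reasoning

    E+E<q : ∀ n → suc (E n ℕ.+ E n) ℕ.≤ q n
    E+E<q n = ℕ.≤-trans (s≤s E+E≤) (ℕ.≤-reflexive (ℕ.m+[n∸m]≡n (ℕ.<⇒≤ (q≥2 n))))
      where
      E+E≤ : E n ℕ.+ E n ℕ.≤ q n ℕ.∸ 1
      E+E≤ = ℕ.≤-trans (ℕ.+-mono-≤ (E≤half n) (ℕ.≤-trans (E≤half n) (ℕ.⌊n/2⌋≤⌈n/2⌉ (q n ℕ.∸ 1))))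
               (ℕ.≤-reflexive (ℕ.⌊n/2⌋+⌈n/2⌉≡n (q n ℕ.∸ 1)))

    E<q : ∀ n → suc (E n) ℕ.≤ q n
    E<q n = ℕ.≤-trans (s≤s (ℕ.m≤m+n (E n) (E n))) (E+E<q n)

    -- Origin of the 3/4: twice 2E + 1 ≤ q, plus 2 ≤ q.
    4[1+E]≤3q : ∀ n → 4 ℕ.* suc (E n) ℕ.≤ 3 ℕ.* q n
    4[1+E]≤3q n = ℕ.≤-trans
      (ℕ.≤-reflexive (solve′ 1
        (λ e → con′ 4 :*′ (con′ 1 :+′ e) :=′
          con′ 2 :*′ (con′ 1 :+′ (e :+′ e)) :+′ con′ 2) refl (E n)))
      (ℕ.≤-trans (ℕ.+-mono-≤ (ℕ.*-monoʳ-≤ 2 (E+E<q n)) (q≥2 n))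
        (ℕ.≤-reflexive (solve′ 1
          (λ x → con′ 2 :*′ x :+′ x :=′ con′ 3 :*′ x) refl (q n))))

    partial : ℕ → ℚ
    -- The leading `0ℚ` is the whole part, so that these are the sums in `CantorExpansion`.
    partial n = 0ℚ ℚ.+ ∑ (λ i → + E i ℚ./ 1 ℚ.* recip 0 (suc i)) n

    partial-suc : ∀ n → partial (suc n) ≡ partial n ℚ.+ ι (E n) ℚ.* recip 0 (suc n)
    partial-suc n = trans
      (sym (ℚ.+-assoc 0ℚ (∑ (λ i → + E i ℚ./ 1 ℚ.* recip 0 (suc i)) n) (+ E n ℚ./ 1 ℚ.* recip 0 (suc n))))
      (cong (λ z → partial n ℚ.+ z ℚ.* recip 0 (suc n)) (sym (ι≡ (E n))))

    partial-suc-+ : ∀ n → partial (suc n) ℚ.+ recip 0 (suc n) ≡ partial n ℚ.+ ι (suc (E n)) ℚ.* recip 0 (suc n)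
    partial-suc-+ n = begin-equality
      partial (suc n) ℚ.+ r                     ≡⟨ cong (ℚ._+ r) (partial-suc n) ⟩
      (partial n ℚ.+ ι (E n) ℚ.* r) ℚ.+ r
        ≡⟨ solve 3 (λ p e r → (p :+ e :* r) :+ r := p :+ (con 1ℚ :+ e) :* r) refl
             (partial n) (ι (E n)) r ⟩
      partial n ℚ.+ (1ℚ ℚ.+ ι (E n)) ℚ.* r
        ≡⟨ cong (λ z → partial n ℚ.+ z ℚ.* r) (ι-suc (E n)) ⟨
      partial n ℚ.+ ι (suc (E n)) ℚ.* r ∎
      where r = recip 0 (suc n)

    partial-mono : ∀ {n m} → n ℕ.≤ m → partial n ℚ.≤ partial m
    partial-mono {n} {m} = ≤-induction n (λ m → partial n ℚ.≤ partial m) ℚ.≤-refl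
      (λ m _ le → ℚ.≤-trans le (difference-≤ (0≤* (0≤ι (E m)) (0≤recip 0 (suc m)))
        (trans (cong (ℚ._- partial m) (partial-suc m))
          (solve 2 (λ p t → p :+ t :- p := t :- con 0ℚ) refl (partial m) (ι (E m) ℚ.* recip 0 (suc m)))))) m

    -- `partial m + recip 0 m` is non-increasing in `m`, because a digit plus 1 is at most its base.
    partial-upper : ∀ {n m} → n ℕ.≤ m → partial m ℚ.≤ partial n ℚ.+ recip 0 n
    partial-upper {n} {m} n≤m = ℚ.≤-trans
      (difference-≤ (0≤recip 0 m) (solve 2 (λ p r → p :+ r :- p := r :- con 0ℚ) refl (partial m) (recip 0 m)))
      (≤-induction n (λ m → partial m ℚ.+ recip 0 m ℚ.≤ partial n ℚ.+ recip 0 n) ℚ.≤-refl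
        (λ m _ le → ℚ.≤-trans (ℚ.≤-reflexive (partial-suc-+ m))
          (ℚ.≤-trans (ℚ.+-monoʳ-≤ (partial m) (recip-suc-≤ 0 m (suc (E m)) (E<q m))) le)) m n≤m)

    partial-close : ∀ {N m n} → N ℕ.≤ m → N ℕ.≤ n → ℚ.∣ partial m ℚ.- partial n ∣ ℚ.≤ recip 0 N
    partial-close {N} {m} {n} N≤m N≤n = ∣p-q∣≤
      (ℚ.≤-trans (partial-upper N≤m) (ℚ.+-monoˡ-≤ (recip 0 N) (partial-mono N≤n)))
      (ℚ.≤-trans (partial-upper N≤n) (ℚ.+-monoˡ-≤ (recip 0 N) (partial-mono N≤m)))

    recip-∏ : ∀ n → recip 0 n ℚ.* ι (∏ q n) ≡ 1ℚ
    recip-∏ zero = trans (cong₂ ℚ._*_ (recip-zero 0) ι-one) (ℚ.*-identityˡ 1ℚ)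
    recip-∏ (suc n) = begin-equality
      recip 0 (suc n) ℚ.* ι (∏ q n ℕ.* q n)
        ≡⟨ cong (recip 0 (suc n) ℚ.*_) (ι-* (∏ q n) (q n)) ⟩
      recip 0 (suc n) ℚ.* (ι (∏ q n) ℚ.* ι (q n))
        ≡⟨ solve 3 (λ r p x → r :* (p :* x) := (r :* x) :* p) refl
             (recip 0 (suc n)) (ι (∏ q n)) (ι (q n)) ⟩
      (recip 0 (suc n) ℚ.* ι (q n)) ℚ.* ι (∏ q n)  ≡⟨ cong (ℚ._* ι (∏ q n)) (recip-step 0 n) ⟩
      recip 0 n ℚ.* ι (∏ q n)                      ≡⟨ recip-∏ n ⟩
      1ℚ ∎

    -- The integer part of q_1⋯q_n x, by Horner's scheme.
    shifted : ℕ → ℕ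
    shifted zero    = 0
    shifted (suc n) = shifted n ℕ.* q n ℕ.+ E n

    shifted≡ : ∀ n → ι (∏ q n) ℚ.* partial n ≡ ι (shifted n)
    shifted≡ zero = trans (ℚ.*-zeroʳ (ι 1)) (sym ι-zero)
    shifted≡ (suc n) = begin-equality
      ι (∏ q n ℕ.* q n) ℚ.* partial (suc n)   ≡⟨ cong (ι (∏ q n ℕ.* q n) ℚ.*_) (partial-suc n) ⟩
      ι (∏ q n ℕ.* q n) ℚ.* (partial n ℚ.+ ι (E n) ℚ.* r)
        ≡⟨ solve 4 (λ a p e r → a :* (p :+ e :* r) := a :* p :+ e :* (r :* a)) refl
             (ι (∏ q n ℕ.* q n)) (partial n) (ι (E n)) r ⟩
      ι (∏ q n ℕ.* q n) ℚ.* partial n ℚ.+ ι (E n) ℚ.* (r ℚ.* ι (∏ q n ℕ.* q n))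
        ≡⟨ cong₂ (λ y z → y ℚ.* partial n ℚ.+ ι (E n) ℚ.* z) (ι-* (∏ q n) (q n)) (recip-∏ (suc n)) ⟩
      (ι (∏ q n) ℚ.* ι (q n)) ℚ.* partial n ℚ.+ ι (E n) ℚ.* 1ℚ
        ≡⟨ solve 4 (λ a b p e → (a :* b) :* p :+ e :* con 1ℚ := (a :* p) :* b :+ e) refl
             (ι (∏ q n)) (ι (q n)) (partial n) (ι (E n)) ⟩
      (ι (∏ q n) ℚ.* partial n) ℚ.* ι (q n) ℚ.+ ι (E n)
        ≡⟨ cong (λ z → z ℚ.* ι (q n) ℚ.+ ι (E n)) (shifted≡ n) ⟩
      ι (shifted n) ℚ.* ι (q n) ℚ.+ ι (E n)   ≡⟨ cong (ℚ._+ ι (E n)) (ι-* (shifted n) (q n)) ⟨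
      ι (shifted n ℕ.* q n) ℚ.+ ι (E n)       ≡⟨ ι-+ (shifted n ℕ.* q n) (E n) ⟨
      ι (shifted (suc n)) ∎
      where r = recip 0 (suc n)

    shifted≤ : ∀ {n m} → n ℕ.≤ m → ι (shifted n) ℚ.≤ ι (∏ q n) ℚ.* partial m
    shifted≤ {n} {m} n≤m = ℚ.≤-trans (ℚ.≤-reflexive (sym (shifted≡ n)))
      (*-monoˡ-≤ (0≤ι (∏ q n)) (partial-mono n≤m))

    -- All digits after `E n` add at most one unit of its place, so the fractional part is at most
    -- (E_n + 1)/q_n.
    ≤shifted+¾ : ∀ {n m} → n ℕ.< m → ι (∏ q n) ℚ.* partial m ℚ.≤ ι (shifted n) ℚ.+ + 3 ℚ./ 4
    ≤shifted+¾ {n} {m} n<m = begin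
      P ℚ.* partial m
        ≤⟨ *-monoˡ-≤ (0≤ι (∏ q n)) (partial-upper n<m) ⟩
      P ℚ.* (partial (suc n) ℚ.+ r)                      ≡⟨ cong (P ℚ.*_) (partial-suc-+ n) ⟩
      P ℚ.* (partial n ℚ.+ e ℚ.* r)
        ≡⟨ solve 4 (λ a p e r → a :* (p :+ e :* r) := a :* p :+ e :* (a :* r)) refl
             P (partial n) e r ⟩
      P ℚ.* partial n ℚ.+ e ℚ.* (P ℚ.* r)
        ≤⟨ ℚ.+-mono-≤ (ℚ.≤-reflexive (shifted≡ n)) ¾-bound ⟩
      ι (shifted n) ℚ.+ + 3 ℚ./ 4 ∎
      where
      P = ι (∏ q n)
      r = recip 0 (suc n)
      e = ι (suc (E n))
      qPr≡1 : ι (q n) ℚ.* (P ℚ.* r) ≡ 1ℚ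
      qPr≡1 = trans (solve 3 (λ x p r → x :* (p :* r) := r :* (p :* x)) refl (ι (q n)) P r)
        (trans (cong (r ℚ.*_) (sym (ι-* (∏ q n) (q n)))) (recip-∏ (suc n)))
      ¾-bound : e ℚ.* (P ℚ.* r) ℚ.≤ + 3 ℚ./ 4
      ¾-bound = ℚ.*-cancelˡ-≤-pos (ι 4) {{ℚ.positive (0<ι-suc 3)}} (begin
        ι 4 ℚ.* (e ℚ.* (P ℚ.* r))        ≡⟨ ℚ.*-assoc (ι 4) e (P ℚ.* r) ⟨
        (ι 4 ℚ.* e) ℚ.* (P ℚ.* r)        ≡⟨ cong (ℚ._* (P ℚ.* r)) (ι-* 4 (suc (E n))) ⟨
        ι (4 ℕ.* suc (E n)) ℚ.* (P ℚ.* r)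
          ≤⟨ *-monoʳ-≤ (0≤* (0≤ι (∏ q n)) (0≤recip 0 (suc n))) (ι-mono (4[1+E]≤3q n)) ⟩
        ι (3 ℕ.* q n) ℚ.* (P ℚ.* r)      ≡⟨ cong (ℚ._* (P ℚ.* r)) (ι-* 3 (q n)) ⟩
        (ι 3 ℚ.* ι (q n)) ℚ.* (P ℚ.* r)  ≡⟨ ℚ.*-assoc (ι 3) (ι (q n)) (P ℚ.* r) ⟩
        ι 3 ℚ.* (ι (q n) ℚ.* (P ℚ.* r))  ≡⟨ cong (ι 3 ℚ.*_) qPr≡1 ⟩
        ι 3 ℚ.* 1ℚ                       ≡⟨ cong (ℚ._* 1ℚ) (ι≡ 3) ⟩
        (+ 4 ℚ./ 1) ℚ.* (+ 3 ℚ./ 4)      ≡⟨ cong (ℚ._* (+ 3 ℚ./ 4)) (ι≡ 4) ⟨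
        ι 4 ℚ.* (+ 3 ℚ./ 4) ∎)

-- From digits to real numbers

/1-mono : ∀ {i j} → i ℤ.≤ j → i ℚ./ 1 ℚ.≤ j ℚ./ 1
/1-mono {i} {j} i≤j = ℚ.toℚᵘ-cancel-≤ (begin
  ℚ.toℚᵘ (i ℚ./ 1)  ≃⟨ ℚ.toℚᵘ-fromℚᵘ (ℚᵘ.mkℚᵘ i 0) ⟩
  ℚᵘ.mkℚᵘ i 0       ≤⟨ ℚᵘ.*≤* (ℤ.*-monoʳ-≤-nonNeg (+ 1) i≤j) ⟩
  ℚᵘ.mkℚᵘ j 0       ≃⟨ ℚ.toℚᵘ-fromℚᵘ (ℚᵘ.mkℚᵘ j 0) ⟨
  ℚ.toℚᵘ (j ℚ./ 1)  ∎)
  where open ℚᵘ.≤-Reasoning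

/1-cancel-< : ∀ {i j} → i ℚ./ 1 ℚ.< j ℚ./ 1 → i ℤ.< j
/1-cancel-< {i} {j} lt with i ℤ.<? j
... | yes i<j = i<j
... | no  i≮j = ⊥-elim (ℚ.<-irrefl refl (ℚ.<-≤-trans lt (/1-mono (ℤ.≮⇒≥ i≮j))))

<+1⇒≤ : ∀ i j → i ℤ.< j ℤ.+ + 1 → i ℤ.≤ j
<+1⇒≤ i j i<j+1 = subst (i ℤ.≤_) (trans (cong ℤ.pred (ℤ.+-comm j (+ 1))) (ℤ.pred-suc j)) (ℤ.i<j⇒i≤pred[j] i<j+1)

count-none : {P : Pred ℕ 0ℓ} (P? : Decidable P) → (∀ n → ¬ P n) → ∀ n → count P? n ≡ 0
count-none P? none zero    = refl
count-none P? none (suc n) = trans (count-suc-no P? n (none n)) (count-none P? none n)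

<-by : ∀ {a b} δ → 0ℚ ℚ.< δ → a ℚ.+ δ ℚ.≤ b → a ℚ.< b
<-by {a} {b} δ 0<δ le = ℚ.<-≤-trans
  (subst (ℚ._< a ℚ.+ δ) (ℚ.+-identityʳ a) (ℚ.+-monoʳ-< a 0<δ)) le

half-slack : ∀ ε {y} → y ℚ.≤ ½ ℚ.* ε → y ℚ.+ ½ ℚ.* ε ℚ.≤ ε
half-slack ε le = ℚ.≤-trans (ℚ.+-monoˡ-≤ (½ ℚ.* ε) le) (ℚ.≤-reflexive (halves ε))

0≤⅞ : fromℚ 0ℚ ≤ fromℚ (+ 7 ℚ./ 8)
0≤⅞ (δ , 0<δ , n , le) = ℚ.<-asym (<-by δ 0<δ (le n ℕ.≤-refl)) (ℚ.positive⁻¹ (+ 7 ℚ./ 8))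

⅞<1 : fromℚ (+ 7 ℚ./ 8) < fromℚ 1ℚ
⅞<1 = + 1 ℚ./ 8 , ℚ.positive⁻¹ (+ 1 ℚ./ 8) , 0 , λ _ _ → ℚ.≤-refl

1≤1 : fromℚ 1ℚ ≤ fromℚ 1ℚ
1≤1 (δ , 0<δ , n , le) = ℚ.<-irrefl refl (<-by δ 0<δ (le n ℕ.≤-refl))

-- [7/8, 1) has length 1/8, so a frequency of 0 misses the limit by more than 1/16.
0-far-from-⅛ : ∀ n c → c ≡ 0 →
  ¬ (∣ fromℚ (+ c ℚ./ suc n) - (fromℚ 1ℚ - fromℚ (+ 7 ℚ./ 8)) ∣ < fromℚ (+ 1 ℚ./ 16))
0-far-from-⅛ n .0 refl (δ , 0<δ , i , le) = from-no (+ 1 ℚ./ 8 ℚ.<? + 1 ℚ./ 16)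
  (subst (ℚ._< + 1 ℚ./ 16) (cong (λ w → ℚ.∣ w ℚ.- (1ℚ ℚ.- + 7 ℚ./ 8) ∣) (ℚ.0/n≡0 (suc n)))
    (<-by δ 0<δ (le i ℕ.≤-refl)))

ratio-close : ∀ {p} q .{{_ : ℚ.Positive q}} η → p ℚ.≤ q ℚ.+ η ℚ.* q → q ℚ.≤ p ℚ.+ η ℚ.* q →
  ℚ.∣ (p ℚ.÷ q) {{ℚ.pos⇒nonZero q}} ℚ.- 1ℚ ∣ ℚ.≤ η
ratio-close {p} q η p≤ q≤ = ∣p-q∣≤
  (begin
    p ℚ.* i                       ≤⟨ *-monoʳ-≤ 0≤i p≤ ⟩
    (q ℚ.+ η ℚ.* q) ℚ.* i
      ≡⟨ solve 3 (λ q e i → (q :+ e :* q) :* i := (q :* i) :+ e :* (q :* i)) refl q η i ⟩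
    q ℚ.* i ℚ.+ η ℚ.* (q ℚ.* i)   ≡⟨ cong (λ z → z ℚ.+ η ℚ.* z) qi≡1 ⟩
    1ℚ ℚ.+ η ℚ.* 1ℚ               ≡⟨ cong (1ℚ ℚ.+_) (ℚ.*-identityʳ η) ⟩
    1ℚ ℚ.+ η ∎)
  (begin
    1ℚ                            ≡⟨ qi≡1 ⟨
    q ℚ.* i                       ≤⟨ *-monoʳ-≤ 0≤i q≤ ⟩
    (p ℚ.+ η ℚ.* q) ℚ.* i
      ≡⟨ solve 4 (λ p q e i → (p :+ e :* q) :* i := p :* i :+ e :* (q :* i)) refl p q η i ⟩
    p ℚ.* i ℚ.+ η ℚ.* (q ℚ.* i)   ≡⟨ cong (λ z → p ℚ.* i ℚ.+ η ℚ.* z) qi≡1 ⟩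
    p ℚ.* i ℚ.+ η ℚ.* 1ℚ          ≡⟨ cong (p ℚ.* i ℚ.+_) (ℚ.*-identityʳ η) ⟩
    p ℚ.* i ℚ.+ η ∎)
  where
  open ℚ.≤-Reasoning
  q≢0 = ℚ.pos⇒nonZero q
  i = (ℚ.1/ q) {{q≢0}}
  qi≡1 : q ℚ.* i ≡ 1ℚ
  qi≡1 = ℚ.*-inverseʳ q {{q≢0}}
  0≤i : 0ℚ ℚ.≤ i
  0≤i = ℚ.<⇒≤ (ℚ.positive⁻¹ ((ℚ.1/ q) {{q≢0}}) {{ℚ.1/pos⇒pos q}})

module _ (Q : BasicSequence) (q→∞ : InfiniteInLimit Q) where
  open BasicSequence Q

  recip-step : ∀ i k → recip i (suc k) ℚ.* ι (q (i ℕ.+ k)) ≡ recip i k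
  recip-step i k = begin
    r′ ℚ.* ι (q (i ℕ.+ k))
      ≡⟨ solve 2 (λ a b → a :* b := con 1ℚ :* (a :* b)) refl r′ (ι (q (i ℕ.+ k))) ⟩
    1ℚ ℚ.* (r′ ℚ.* ι (q (i ℕ.+ k)))
      ≡⟨ cong (ℚ._* (r′ ℚ.* ι (q (i ℕ.+ k)))) (1/-inverse P {{∏-nonZero i k}}) ⟨
    (r ℚ.* ι P) ℚ.* (r′ ℚ.* ι (q (i ℕ.+ k)))
      ≡⟨ solve 4 (λ r p r′ b → (r :* p) :* (r′ :* b) := r :* (r′ :* (p :* b))) refl
           r (ι P) r′ (ι (q (i ℕ.+ k))) ⟩
    r ℚ.* (r′ ℚ.* (ι P ℚ.* ι (q (i ℕ.+ k))))
      ≡⟨ cong (λ z → r ℚ.* (r′ ℚ.* z)) (ι-* P (q (i ℕ.+ k))) ⟨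
    r ℚ.* (r′ ℚ.* ι (P ℕ.* q (i ℕ.+ k)))
      ≡⟨ cong (r ℚ.*_) (1/-inverse (P ℕ.* q (i ℕ.+ k)) {{∏-nonZero i (suc k)}}) ⟩
    r ℚ.* 1ℚ ≡⟨ ℚ.*-identityʳ r ⟩
    r ∎
    where
    open ≡-Reasoning
    P  = ∏ (λ j → q (i ℕ.+ j)) k
    r  = recip i k
    r′ = recip i (suc k)

  0≤recip : ∀ i k → 0ℚ ℚ.≤ recip i k
  0≤recip i k = ℚ.<⇒≤ (ℚ.positive⁻¹ (recip i k) {{recip-pos i k}})

  module Greedy = Construction q q≥2 recip (λ _ → refl) recip-step 0≤recip

  recip-vanishes : ∀ ε → 0ℚ ℚ.< ε → ∃[ n ] recip 0 n ℚ.≤ ε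
  recip-vanishes ε 0<ε = suc n , (begin
    r                              ≡⟨ ℚ.*-identityʳ r ⟨
    r ℚ.* 1ℚ                       ≤⟨ *-monoˡ-≤ (0≤recip 0 (suc n)) (scaled-bound ε 1ℚ big) ⟩
    r ℚ.* (ε ℚ.* ι (q n))
      ≡⟨ solve 3 (λ r e x → r :* (e :* x) := e :* (r :* x)) refl r ε (ι (q n)) ⟩
    ε ℚ.* (r ℚ.* ι (q n))          ≡⟨ cong (ε ℚ.*_) (recip-step 0 n) ⟩
    ε ℚ.* recip 0 n                ≤⟨ *-monoˡ-≤ (ℚ.<⇒≤ 0<ε) (Greedy.recip-anti 0 {0} {n} z≤n) ⟩
    ε ℚ.* 1ℚ                       ≡⟨ ℚ.*-identityʳ ε ⟩
    ε ∎)
    where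
    open ℚ.≤-Reasoning
    instance
      ε-pos : ℚ.Positive ε
      ε-pos = ℚ.positive 0<ε
    M = 1ℚ ℚ.* (ℚ.1/ ε) {{ℚ.pos⇒nonZero ε}}
    n = proj₁ (q→∞ M)
    r = recip 0 (suc n)
    big : M ℚ.≤ ι (q n)
    big = ℚ.≤-trans (ℚ.<⇒≤ (proj₂ (q→∞ M) n ℕ.≤-refl)) (ℚ.≤-reflexive (sym (ι≡ (q n))))

  module _ (E : ℕ → ℕ) (E≤half : ∀ n → E n ℕ.≤ ⌊ q n ℕ.∸ 1 /2⌋) where
    open Greedy.PartialSums E E≤half

    sum-cauchy : IsCauchy partial
    sum-cauchy ε 0<ε = proj₁ tiny , λ m n N≤m N≤n → <-by (½ ℚ.* ε) (half-pos 0<ε)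
      (half-slack ε (ℚ.≤-trans (partial-close N≤m N≤n) (proj₂ tiny)))
      where tiny = recip-vanishes (½ ℚ.* ε) (half-pos 0<ε)

    number : ℝ
    number = mkℝ partial sum-cauchy

    0≤number : fromℤ (+ 0) ≤ number
    0≤number (δ , 0<δ , n , le) = ℚ.<-irrefl refl
      (ℚ.≤-<-trans (partial-mono {0} {n} z≤n) (<-by δ 0<δ (le n ℕ.≤-refl)))

    number<1 : number < fromℤ (+ 1)
    -- The gap is 1 - 3/4, valid from index 1 on, as `≤shifted+¾` with `n = 0` needs one digit.
    number<1 = + 1 ℚ./ 4 , ℚ.positive⁻¹ (+ 1 ℚ./ 4) , 1 , λ n 1≤n →
      ℚ.+-monoˡ-≤ (+ 1 ℚ./ 4) (subst₂ ℚ._≤_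
        (trans (cong (ℚ._* partial n) ι-one) (ℚ.*-identityˡ (partial n)))
        (trans (cong (ℚ._+ + 3 ℚ./ 4) ι-zero) (ℚ.+-identityˡ (+ 3 ℚ./ 4))) (≤shifted+¾ 1≤n))

    converges : (λ n → fromℚ (partial n)) ⟶ number
    converges ε 0<ε = proj₁ tiny , λ n N≤n → ½ ℚ.* ε , half-pos 0<ε , proj₁ tiny , λ m N≤m →
      half-slack ε (ℚ.≤-trans (partial-close N≤n N≤m) (proj₂ tiny))
      where tiny = recip-vanishes (½ ℚ.* ε) (half-pos 0<ε)

    expansion : CantorExpansion Q number
    expansion = record
      { whole    = + 0
      ; digit    = E
      ; floor    = 0≤number , number<1
      ; digit<q  = E<q
      ; nonmax   = λ m → m , ℕ.≤-refl , λ e → ℕ.<-irrefl e (ℕ.≤-<-trans (E≤half m) (half< m))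
      ; converge = converges
      }
      where
      half< : ∀ n → ⌊ q n ℕ.∸ 1 /2⌋ ℕ.< q n ℕ.∸ 1
      half< n with q n | q≥2 n
      ... | suc (suc r) | s≤s (s≤s z≤n) = ℕ.⌊n/2⌋<n r

    orbit : ℕ → ℝ
    orbit n = (+ ∏ q n ℚ./ 1) · number

    -- T_n(x) mod 1 stays below 3/4, because the digit E_{n+1} is less than q_{n+1}/2.
    orbit-avoids : ∀ n → ¬ FracIn[ fromℚ (+ 7 ℚ./ 8) , fromℚ 1ℚ ⟩ (orbit n)
    orbit-avoids n (m , (_ , δ , 0<δ , i , y<m+1) , a≤y-m , _) =
      a≤y-m (+ 1 ℚ./ 8 , ℚ.positive⁻¹ (+ 1 ℚ./ 8) , suc n , below)
      where
      open ℚ.≤-Reasoning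
      P = + ∏ q n ℚ./ 1
      z = shifted n
      -- Any floor `m` of the orbit point is at least `z`, so subtracting `m` leaves at most 3/4,
      -- which is 1/8 below the interval.
      z≤m : + z ℤ.≤ m
      z≤m = <+1⇒≤ (+ z) m (/1-cancel-< (<-by δ 0<δ (begin
        (+ z ℚ./ 1) ℚ.+ δ              ≡⟨ cong (ℚ._+ δ) (ι≡ z) ⟨
        ι z ℚ.+ δ
          ≤⟨ ℚ.+-monoˡ-≤ δ (shifted≤ (ℕ.≤-trans (ℕ.n≤1+n n) (ℕ.m≤n+m (suc n) i))) ⟩
        ι (∏ q n) ℚ.* partial (i ℕ.+ suc n) ℚ.+ δ
          ≡⟨ cong (λ w → w ℚ.* partial (i ℕ.+ suc n) ℚ.+ δ) (ι≡ (∏ q n)) ⟩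
        P ℚ.* partial (i ℕ.+ suc n) ℚ.+ δ  ≤⟨ y<m+1 (i ℕ.+ suc n) (ℕ.m≤m+n i (suc n)) ⟩
        (m ℤ.+ + 1) ℚ./ 1 ∎)))
      below : ∀ j → suc n ℕ.≤ j → (P ℚ.* partial j ℚ.- m ℚ./ 1) ℚ.+ + 1 ℚ./ 8 ℚ.≤ + 7 ℚ./ 8
      below j n<j = begin
        (P ℚ.* partial j ℚ.- m ℚ./ 1) ℚ.+ + 1 ℚ./ 8
          ≡⟨ cong (λ w → (w ℚ.* partial j ℚ.- m ℚ./ 1) ℚ.+ + 1 ℚ./ 8) (ι≡ (∏ q n)) ⟨
        (ι (∏ q n) ℚ.* partial j ℚ.- m ℚ./ 1) ℚ.+ + 1 ℚ./ 8
          ≤⟨ ℚ.+-monoˡ-≤ (+ 1 ℚ./ 8) (ℚ.+-monoˡ-≤ (ℚ.- (m ℚ./ 1)) (≤shifted+¾ n<j)) ⟩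
        ((ι z ℚ.+ + 3 ℚ./ 4) ℚ.- m ℚ./ 1) ℚ.+ + 1 ℚ./ 8
          ≤⟨ ℚ.+-monoˡ-≤ (+ 1 ℚ./ 8) (ℚ.+-monoˡ-≤ (ℚ.- (m ℚ./ 1)) (ℚ.+-monoˡ-≤ (+ 3 ℚ./ 4)
               (ℚ.≤-trans (ℚ.≤-reflexive (ι≡ z)) (/1-mono z≤m)))) ⟩
        ((m ℚ./ 1 ℚ.+ + 3 ℚ./ 4) ℚ.- m ℚ./ 1) ℚ.+ + 1 ℚ./ 8
          ≡⟨ cong (ℚ._+ + 1 ℚ./ 8) (solve 2 (λ m t → m :+ t :- m := t) refl (m ℚ./ 1) (+ 3 ℚ./ 4)) ⟩
        + 7 ℚ./ 8 ∎

    hit? : Decidable λ n → FracIn[ fromℚ (+ 7 ℚ./ 8) , fromℚ 1ℚ ⟩ (orbit n)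
    hit? n = no (orbit-avoids n)

    not-DN : ¬ DN Q number
    not-DN ud = 0-far-from-⅛ (proj₁ close) (count hit? (suc (proj₁ close)))
      (count-none hit? orbit-avoids (suc (proj₁ close))) (proj₂ close (proj₁ close) ℕ.≤-refl)
      where
      close = ud (fromℚ (+ 7 ℚ./ 8)) (fromℚ 1ℚ) 0≤⅞ ⅞<1 1≤1 hit? (+ 1 ℚ./ 16) (ℚ.positive⁻¹ (+ 1 ℚ./ 16))

    module _ (normal : ∀ η → 0ℚ ℚ.< η → ∀ {k} (B : Vec ℕ (suc k)) → Eventually λ n →
        ι (occurrences B E (suc n)) ℚ.≤ Q⟨ suc k ⟩ (suc n) ℚ.+ (η ℚ.+ η) ℚ.* Q⟨ suc k ⟩ (suc n) ×
        Q⟨ suc k ⟩ (suc n) ℚ.≤ ι (occurrences B E (suc n)) ℚ.+ (η ℚ.+ η) ℚ.* Q⟨ suc k ⟩ (suc n)) where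

      in-N : N Q number
      in-N = expansion , frequency
        where
        frequency : ∀ k → 1 ℕ.≤ k → (B : Vec ℕ k) →
          (λ n → fromℚ (ℚ._÷_ (+ occurrences B E (suc n) ℚ./ 1) (Q⟨ k ⟩ (suc n)) {{Q-nonZero k n}})) ⟶ fromℚ 1ℚ
        frequency (suc k) _ B ε 0<ε = proj₁ ev , λ n N≤n → ½ ℚ.* ε , half-pos 0<ε , 0 , λ _ _ →
          half-slack ε (subst (λ w → ℚ.∣ ℚ._÷_ w (Q⟨ suc k ⟩ (suc n)) {{Q-nonZero (suc k) n}} ℚ.- 1ℚ ∣ ℚ.≤ ½ ℚ.* ε)
            (ι≡ (occurrences B E (suc n)))
            (ratio-close (Q⟨ suc k ⟩ (suc n)) {{Q-pos (suc k) n}} (½ ℚ.* ε)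
              (subst (λ w → ι (occurrences B E (suc n)) ℚ.≤ Q⟨ suc k ⟩ (suc n) ℚ.+ w ℚ.* Q⟨ suc k ⟩ (suc n))
                η+η (proj₁ (proj₂ ev n N≤n)))
              (subst (λ w → Q⟨ suc k ⟩ (suc n) ℚ.≤ ι (occurrences B E (suc n)) ℚ.+ w ℚ.* Q⟨ suc k ⟩ (suc n))
                η+η (proj₂ (proj₂ ev n N≤n)))))
          where
          -- The counting bounds carry the error 2η = ε/2; the other half of ε makes the inequality
          -- strict.
          η = ½ ℚ.* (½ ℚ.* ε)
          η+η : η ℚ.+ η ≡ ½ ℚ.* ε
          η+η = halves (½ ℚ.* ε)
          ev = normal η (half-pos (half-pos 0<ε)) B

theorem3p12 : (Q : BasicSequence) → InfiniteInLimit Q → FullyDivergent Q →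
    ∃[ x ] (N Q x × ¬ DN Q x)
theorem3p12 Q q→∞ Q→∞ =
  let (E , E≤half , normal) = Greedy.normal-digits Q q→∞ q-eventually (λ k → Q→∞ (suc k) (s≤s z≤n))
  in number Q q→∞ E E≤half , in-N Q q→∞ E E≤half normal , not-DN Q q→∞ E E≤half
  where
  open BasicSequence Q
  q-eventually : ∀ m → Eventually (λ j → m ℕ.≤ q j)
  q-eventually m = eventually-map (λ j m<q → ℕ.<⇒≤ (ι-cancel-<
    (subst₂ ℚ._<_ (sym (ι≡ m)) (sym (ι≡ (q j))) m<q))) (q→∞ (+ m ℚ./ 1))
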